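{- Let $m\ge 4$ and $n\ge 1$, and let $T$ be a triangulation of the grid-covered cylinder graph $G_{m,n}$. Then $T$ is word-representable if and only if $T$ contains neither the wheel graph $W_5$ nor the wheel graph $W_7$ as an induced subgraph.
   Context: A simple graph $G=(V,E)$ is word-representable if there is a word $w$ over the alphabet $V$, containing every letter of $V$, such that for all distinct $x,y\in V$, the letters $x$ and $y$ alternate in $w$ (deleting all other letters leaves $xyxy\cdots$ or $yxyx\cdots$) if and only if $xy\in E$. The grid-covered cylinder graph $G_{m,n}$ ($m$ sectors, $n$ layers) has vertex set $\{v_{ij}: 0\le i\le n,\ 0\le j\le m-1\}$ and edges $v_{ij}v_{i,j+1}$ (horizontal edges, second index mod $m$) and $v_{ij}v_{i+1,j}$ for $0\le i\le n-1$ (vertical edges). Its cells are the $mn$ 4-cycles $v_{ij}v_{i+1,j}v_{i+1,j+1}v_{i,j+1}$ ($0\le i\le n-1$, $0\le j\le m-1$, second index mod $m$). A triangulation of $G_{m,n}$ is a graph obtained from $G_{m,n}$ by adding, in each cell, exactly one of its two diagonals as an edge. For $k\ge 3$, the wheel graph $W_k$ is the cycle $C_k$ together with an extra vertex adjacent to all vertices of the cycle. -}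

module Defs where

open import Data.Nat using (ℕ; zero; suc; _≤_)
open import Data.Fin using (Fin; toℕ; inject₁) renaming (zero to fzero; suc to fsuc)
import Data.Fin.Properties as FinP
open import Data.Bool using (Bool; true; false)
open import Data.List using (List; []; _∷_; filter)
open import Data.List.Membership.Propositional using (_∈_)
open import Data.Product using (Σ; ∃; _×_; _,_)
import Data.Product.Properties as ProdP
open import Data.Sum using (_⊎_)
open import Relation.Nullary using (¬_)
open import Relation.Nullary.Decidable using (_⊎-dec_)
open import Relation.Binary using (DecidableEquality)
open import Relation.Binary.PropositionalEquality using (_≡_; _≢_)
open import Function.Bundles using (_⇔_)

data NoConsecRepeat {V : Set} : List V → Set where
  nil  : NoConsecRepeat []
  one  : ∀ x → NoConsecRepeat (x ∷ [])
  cons : ∀ {x y w} → x ≢ y → NoConsecRepeat (y ∷ w) → NoConsecRepeat (x ∷ y ∷ w)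

Alternate : {V : Set} → DecidableEquality V → V → V → List V → Set
Alternate _≟_ x y w = NoConsecRepeat (filter (λ z → (z ≟ x) ⊎-dec (z ≟ y)) w)

WordRepresentable : (V : Set) → DecidableEquality V → (V → V → Set) → Set
WordRepresentable V _≟_ Adj =
  Σ (List V) λ w →
    (∀ x → x ∈ w) ×
    (∀ x y → x ≢ y → (Alternate _≟_ x y w ⇔ Adj x y))

NextMod : (m : ℕ) → Fin m → Fin m → Set
NextMod m j j' = (toℕ j' ≡ suc (toℕ j)) ⊎ ((toℕ j' ≡ 0) × (suc (toℕ j) ≡ m))

data WheelAdj (k : ℕ) : Fin (suc k) → Fin (suc k) → Set where
  hub-rim : ∀ i → WheelAdj k fzero (fsuc i)
  rim-hub : ∀ i → WheelAdj k (fsuc i) fzero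
  rim-fwd : ∀ i j → NextMod k i j → WheelAdj k (fsuc i) (fsuc j)
  rim-bwd : ∀ i j → NextMod k j i → WheelAdj k (fsuc i) (fsuc j)

InducedSubgraph : (h : ℕ) (HAdj : Fin h → Fin h → Set) (V : Set) (Adj : V → V → Set) → Set
InducedSubgraph h HAdj V Adj =
  Σ (Fin h → V) λ f →
    (∀ a b → f a ≡ f b → a ≡ b) ×
    (∀ a b → a ≢ b → (HAdj a b ⇔ Adj (f a) (f b)))

-- Grid-covered cylinder G_{m,n} and its triangulations.
-- Vertex v_{ij} is (i , j) with i : Fin (suc n) (layer 0..n), j : Fin m (sector).

Vertex : ℕ → ℕ → Set
Vertex m n = Fin (suc n) × Fin m

_≟V_ : ∀ {m n} → DecidableEquality (Vertex m n)
_≟V_ = ProdP.≡-dec FinP._≟_ FinP._≟_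

-- A triangulation is a choice of diagonal in each cell (c , j), c : Fin n, j : Fin m.
-- true  : diagonal v_{c,j} v_{c+1,j+1}
-- false : diagonal v_{c+1,j} v_{c,j+1}
Triangulation : ℕ → ℕ → Set
Triangulation m n = Fin n → Fin m → Bool

data TEdge (m n : ℕ) (d : Triangulation m n) : Vertex m n → Vertex m n → Set where
  horiz : ∀ i j j' → NextMod m j j' → TEdge m n d (i , j) (i , j')
  vert  : ∀ (c : Fin n) j → TEdge m n d (inject₁ c , j) (fsuc c , j)
  diag₁ : ∀ (c : Fin n) j j' → NextMod m j j' → d c j ≡ true →
          TEdge m n d (inject₁ c , j) (fsuc c , j')
  diag₂ : ∀ (c : Fin n) j j' → NextMod m j j' → d c j ≡ false →
          TEdge m n d (fsuc c , j) (inject₁ c , j')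

TAdj : ∀ m n → Triangulation m n → Vertex m n → Vertex m n → Set
TAdj m n d u v = TEdge m n d u v ⊎ TEdge m n d v u

{-# OPTIONS --safe #-}

-- If w represents T, then around every vertex x the order in which the neighbours of x occur
-- between consecutive x's orients the neighbourhood of x transitively, so the rim of an
-- induced wheel must be an even cycle.
--
-- Conversely, an interior vertex of odd degree is the hub of an induced W₅ or W₇; if there
-- are none, then the diagonal of the cell (c , j) is given by d c j = (g c == h j) for signs
-- g, h. Colour v_{ij} by A i + C j modulo 4, where A changes by g c (= ±1) across layer c,
-- and C changes across sector j by 2 or, in at most two sectors, by h j; the two exceptional
-- sectors are needed exactly when m is odd, to make C periodic. The colouring is proper. An
-- edge raising the colour by 1 changes (A , B), where B is the sum of the signs h, by
-- (1 , 0), (0 , 1) or (-1 , -1). A closed walk of 4 such edges that does not wind around the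
-- cylinder would use the three kinds equally often, which 3 ∤ 4 forbids; one that winds has
-- m = 4 and only edges of kind (0 , 1), which are absent for even m. So no 4-cycle has the
-- colours 0, 1, 2, 3 in this order. Therefore orienting all edges towards the larger colour gives an acyclic orientation
-- without shortcuts, and such an orientation is turned into a word by concatenating, for
-- every non-adjacent pair x, y, a word that respects all edges and breaks the pair x, y.
module Submission where

open import Defs
open import Algebra.Properties.AbelianGroup using (identityˡ-unique)
open import Data.Bool using (Bool; true; false; not; _xor_; T?)
import Data.Bool.Properties as Bool
open import Data.Empty using (⊥; ⊥-elim)
open import Data.Fin using (Fin; toℕ; inject₁; fromℕ<) renaming (zero to fzero; suc to fsuc)
open import Data.Fin.Induction using (<-weakInduction)
open import Data.Fin.Patterns using (0F; 1F; 2F; 3F)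
import Data.Fin.Properties as Fin
open import Data.Integer using (ℤ; 0ℤ; 1ℤ; -1ℤ) renaming (_+_ to _+ℤ_)
import Data.Integer.Properties as ℤ
open import Data.List using (List; []; _∷_; _++_; filter; filterᵇ; concatMap; allFin; cartesianProduct)
open import Data.List.Membership.Propositional using (_∈_; find; lose)
open import Data.List.Membership.Propositional.Properties using (∈-++⁺ˡ; ∈-filter⁺; ∈-filter⁻; ∈-cartesianProduct⁺; ∈-allFin)
open import Data.List.Properties using (filter-++)
open import Data.List.Relation.Binary.Permutation.Propositional using (↭-sym; ↭⇒↭ₛ)
open import Data.List.Relation.Binary.Permutation.Propositional.Properties using (∈-resp-↭)
import Data.List.Relation.Binary.Permutation.Setoid.Properties as Permutationₛ
open import Data.List.Relation.Unary.All using ([]; _∷_)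
open import Data.List.Relation.Unary.AllPairs using (AllPairs; []; _∷_)
import Data.List.Relation.Unary.AllPairs.Properties as AllPairs
open import Data.List.Relation.Unary.Any using (here; there; any?)
open import Data.List.Relation.Unary.Sorted.TotalOrder.Properties using (Sorted⇒AllPairs)
open import Data.List.Relation.Unary.Unique.Propositional using (Unique)
import Data.List.Relation.Unary.Unique.Propositional.Properties as Unique
import Data.List.Sort
open import Data.Nat using (ℕ; zero; suc; _+_; _*_; _≤_; _<_; z≤n; s≤s)
open import Data.Nat.DivMod using (_mod_)
open import Data.Nat.GeneralisedArithmetic using (fold)
import Data.Nat.Properties as ℕ
open import Data.Product using (∃; _×_; _,_; proj₁; proj₂)
import Data.Product.Properties as Product
open import Data.Sum using (_⊎_; inj₁; inj₂; [_,_]′; swap)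
import Data.Sum as Sum
open import Data.Vec using (Vec; []; _∷_; lookup)
open import Function using (_∘_)
open import Function.Bundles using (_⇔_; mk⇔; Equivalence)
open import Relation.Binary using (DecidableEquality; DecTotalOrder)
open import Relation.Binary.Construct.Closure.ReflexiveTransitive using (Star; ε; _◅_; _◅◅_)
import Relation.Binary.Construct.On as On
open import Relation.Binary.Definitions using (tri<; tri≈; tri>)
open import Relation.Binary.PropositionalEquality
open import Relation.Nullary using (¬_; Dec; yes; no; ¬?; does)
open import Relation.Nullary.Decidable using (_⊎-dec_; _×-dec_; _→-dec_; map′; from-yes; True; toWitness; dec-true; dec-false)
open import Relation.Unary using (Decidable)
open Equivalence using (to; from)

-- Alternation and odd wheels

module Alternation {V : Set} (_≟_ : DecidableEquality V) where

  -- The letters a and b alternate in the word and the next of them to be read is a.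
  data Alt (a b : V) : List V → Set where
    done : a ≢ b → Alt a b []
    skip : ∀ {z w} → z ≢ a → z ≢ b → Alt a b w → Alt a b (z ∷ w)
    read : ∀ {w} → Alt b a w → Alt a b (a ∷ w)

  Alt⇒≢ : ∀ {a b w} → Alt a b w → a ≢ b
  Alt⇒≢ (done a≢b)   = a≢b
  Alt⇒≢ (skip _ _ p) = Alt⇒≢ p
  Alt⇒≢ (read p)     = ≢-sym (Alt⇒≢ p)

  Alt-blocks : ∀ {a b z w} → Alt a b (z ∷ w) → z ≢ b
  Alt-blocks (skip _ z≢b _) = z≢b
  Alt-blocks (read p)       = ≢-sym (Alt⇒≢ p)

  Alt-take : ∀ {a b w} → Alt a b (a ∷ w) → Alt b a w
  Alt-take (skip a≢a _ _) = ⊥-elim (a≢a refl)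
  Alt-take (read p)       = p

  Alt-drop : ∀ {a b z w} → z ≢ a → Alt a b (z ∷ w) → Alt a b w
  Alt-drop _   (skip _ _ p) = p
  Alt-drop a≢a (read _)     = ⊥-elim (a≢a refl)

  Restrict : V → V → List V → List V
  Restrict x y = filter (λ z → (z ≟ x) ⊎-dec (z ≟ y))

  module _ {x y : V} (x≢y : x ≢ y) where mutual

    after-x : ∀ w → NoConsecRepeat (x ∷ Restrict x y w) → Alt y x w
    after-x []      _ = done (≢-sym x≢y)
    after-x (z ∷ w) p with z ≟ x | z ≟ y
    after-x (z ∷ w) (cons x≢z _) | yes refl | _        = ⊥-elim (x≢z refl)
    after-x (z ∷ w) (cons _ p)   | no _     | yes refl = read (after-y w p)
    after-x (z ∷ w) p            | no z≢x   | no z≢y   = skip z≢y z≢x (after-x w p)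

    after-y : ∀ w → NoConsecRepeat (y ∷ Restrict x y w) → Alt x y w
    after-y []      _ = done x≢y
    after-y (z ∷ w) p with z ≟ x | z ≟ y
    after-y (z ∷ w) (cons _ p)   | yes refl | _        = read (after-x w p)
    after-y (z ∷ w) (cons y≢z _) | no _     | yes refl = ⊥-elim (y≢z refl)
    after-y (z ∷ w) p            | no z≢x   | no z≢y   = skip z≢x z≢y (after-y w p)

  module _ {x y : V} (x≢y : x ≢ y) where mutual

    before-x : ∀ {w} → Alt y x w → NoConsecRepeat (x ∷ Restrict x y w)
    before-x (done _) = one x
    before-x (skip {z} z≢y z≢x p) with z ≟ x | z ≟ y
    ... | yes z≡x | _       = ⊥-elim (z≢x z≡x)
    ... | no _    | yes z≡y = ⊥-elim (z≢y z≡y)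
    ... | no _    | no _    = before-x p
    before-x (read p) with y ≟ x | y ≟ y
    ... | yes y≡x | _      = ⊥-elim (x≢y (sym y≡x))
    ... | no _    | yes _  = cons x≢y (before-y p)
    ... | no _    | no y≢y = ⊥-elim (y≢y refl)

    before-y : ∀ {w} → Alt x y w → NoConsecRepeat (y ∷ Restrict x y w)
    before-y (done _) = one y
    before-y (skip {z} z≢x z≢y p) with z ≟ x | z ≟ y
    ... | yes z≡x | _       = ⊥-elim (z≢x z≡x)
    ... | no _    | yes z≡y = ⊥-elim (z≢y z≡y)
    ... | no _    | no _    = before-y p
    before-y (read p) with x ≟ x
    ... | yes _  = cons (≢-sym x≢y) (before-x p)
    ... | no x≢x = ⊥-elim (x≢x refl)

  NoConsecRepeat-tail : ∀ {x : V} {w} → NoConsecRepeat (x ∷ w) → NoConsecRepeat w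
  NoConsecRepeat-tail (one _)    = nil
  NoConsecRepeat-tail (cons _ p) = p

  Alternate⇒Alt : ∀ {x y} → x ≢ y → ∀ w → Alternate _≟_ x y w → Alt x y w ⊎ Alt y x w
  Alternate⇒Alt x≢y [] _ = inj₁ (done x≢y)
  Alternate⇒Alt {x} {y} x≢y (z ∷ w) p with z ≟ x | z ≟ y
  ... | yes refl | _        = inj₁ (read (after-x x≢y w p))
  ... | no _     | yes refl = inj₂ (read (after-y x≢y w p))
  ... | no z≢x   | no z≢y   with Alternate⇒Alt x≢y w p
  ...   | inj₁ q = inj₁ (skip z≢x z≢y q)
  ...   | inj₂ q = inj₂ (skip z≢y z≢x q)

  Alt⇒Alternate : ∀ {x y} → x ≢ y → ∀ {w} → Alt x y w ⊎ Alt y x w → Alternate _≟_ x y w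
  Alt⇒Alternate x≢y (inj₁ p) = NoConsecRepeat-tail (before-y x≢y p)
  Alt⇒Alternate x≢y (inj₂ p) = NoConsecRepeat-tail (before-x x≢y p)

  Alternate-sym : ∀ {x y} → x ≢ y → ∀ w → Alternate _≟_ x y w → Alternate _≟_ y x w
  Alternate-sym x≢y w p = Alt⇒Alternate (≢-sym x≢y) (swap (Alternate⇒Alt x≢y w p))

  -- Together the hypotheses block both letters, and reading any other letter preserves them, so `a`
  -- could never be read.
  Alt-asym : ∀ {a b w} → a ∈ w → Alt a b w → ¬ Alt b a w
  Alt-asym (here refl) _  ba = Alt-blocks ba refl
  Alt-asym (there a∈w) ab ba = Alt-asym a∈w (Alt-drop (Alt-blocks ba) ab) (Alt-drop (Alt-blocks ab) ba)

  -- As for two letters: each of the three is blocked by one hypothesis.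
  Alt-acyclic : ∀ {a b c w} → a ∈ w → Alt a b w → Alt b c w → ¬ Alt c a w
  Alt-acyclic (here refl) _  _  ca = Alt-blocks ca refl
  Alt-acyclic (there a∈w) ab bc ca =
    Alt-acyclic a∈w (Alt-drop (Alt-blocks ca) ab) (Alt-drop (Alt-blocks ab) bc) (Alt-drop (Alt-blocks bc) ca)

  -- If all pairs but one of a, b, c, d are known to be read in the order a, b, c, d,
  -- then reading a turns the situation for (a, b, c, d) into the one for (b, c, d, a);
  -- the position of the remaining pair changes from (1st, 3rd) to (2nd, 4th) and back.
  mutual
    Alt-1st-3rd : ∀ {a b c d} w → a ≢ c →
      Alt a b w → Alt a d w → Alt b c w → Alt b d w → Alt c d w → Alt a c w
    Alt-1st-3rd [] a≢c _ _ _ _ _ = done a≢c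
    Alt-1st-3rd {a} (z ∷ w) a≢c ab ad bc bd cd with z ≟ a
    ... | yes refl = read (Alt-2nd-4th w (≢-sym a≢c) (Alt-drop a≢b bc) (Alt-drop a≢b bd) (Alt-take ab)
                             (Alt-drop a≢c cd) (Alt-take ad))
      where a≢b = Alt-blocks ab
    ... | no z≢a = skip z≢a (Alt-blocks bc)
                     (Alt-1st-3rd w a≢c (Alt-drop z≢a ab) (Alt-drop z≢a ad) (Alt-drop (Alt-blocks ab) bc)
                       (Alt-drop (Alt-blocks ab) bd) (Alt-drop (Alt-blocks bc) cd))

    Alt-2nd-4th : ∀ {a b c d} w → b ≢ d →
      Alt a b w → Alt a c w → Alt a d w → Alt b c w → Alt c d w → Alt b d w
    Alt-2nd-4th [] b≢d _ _ _ _ _ = done b≢d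
    Alt-2nd-4th {a} (z ∷ w) b≢d ab ac ad bc cd with z ≟ a
    ... | yes refl = skip a≢b (Alt-blocks ad)
                       (Alt-1st-3rd w b≢d (Alt-drop a≢b bc) (Alt-take ab) (Alt-drop a≢c cd) (Alt-take ac) (Alt-take ad))
      where a≢b = Alt-blocks ab
            a≢c = Alt-blocks ac
    ... | no z≢a = skip (Alt-blocks ab) (Alt-blocks ad)
                     (Alt-2nd-4th w b≢d (Alt-drop z≢a ab) (Alt-drop z≢a ac) (Alt-drop z≢a ad)
                       (Alt-drop (Alt-blocks ab) bc) (Alt-drop (Alt-blocks ac) cd))

  Linear : V → V → V → List V → Set
  Linear a b c w = Alt a b w × Alt b c w × Alt a c w

  -- The restriction of the word to {a, b, c} is a factor of abcabc⋯.
  Cyclic : V → V → V → List V → Set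
  Cyclic a b c w = Linear a b c w ⊎ Linear b c a w ⊎ Linear c a b w

  -- Of the eight tournaments on three letters `Alt-acyclic` excludes the two cyclic ones; the other
  -- six are the rotations of the two cyclic orders.
  cyclic-cases : ∀ {x y z w} → x ∈ w →
    Alt x y w ⊎ Alt y x w → Alt y z w ⊎ Alt z y w → Alt x z w ⊎ Alt z x w →
    Cyclic x y z w ⊎ Cyclic x z y w
  cyclic-cases x∈w (inj₁ xy) (inj₁ yz) (inj₁ xz) = inj₁ (inj₁ (xy , yz , xz))
  cyclic-cases x∈w (inj₁ xy) (inj₁ yz) (inj₂ zx) = ⊥-elim (Alt-acyclic x∈w xy yz zx)
  cyclic-cases x∈w (inj₁ xy) (inj₂ zy) (inj₁ xz) = inj₂ (inj₁ (xz , zy , xy))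
  cyclic-cases x∈w (inj₁ xy) (inj₂ zy) (inj₂ zx) = inj₁ (inj₂ (inj₂ (zx , xy , zy)))
  cyclic-cases x∈w (inj₂ yx) (inj₁ yz) (inj₁ xz) = inj₂ (inj₂ (inj₂ (yx , xz , yz)))
  cyclic-cases x∈w (inj₂ yx) (inj₁ yz) (inj₂ zx) = inj₁ (inj₂ (inj₁ (yz , zx , yx)))
  cyclic-cases x∈w (inj₂ yx) (inj₂ zy) (inj₁ xz) = ⊥-elim (Alt-acyclic x∈w xz zy yx)
  cyclic-cases x∈w (inj₂ yx) (inj₂ zy) (inj₂ zx) = inj₂ (inj₂ (inj₁ (zy , yx , zx)))

  -- This is transitivity of the orientation of the neighbourhood of `x`. The hypotheses must agree
  -- on which of `x` and `z` comes first; the surviving combinations are the four rotations of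
  -- `x y z t`, with only the pair `y`, `t` unknown.
  cyclic-trans : ∀ {x y z t w} → x ∈ w → y ≢ t →
    Cyclic x y z w → Cyclic x z t w → Alt y t w ⊎ Alt t y w
  cyclic-trans x∈w y≢t (inj₁ (xy , yz , xz)) (inj₁ (_ , zt , xt)) =
    inj₁ (Alt-2nd-4th _ y≢t xy xz xt yz zt)
  cyclic-trans x∈w y≢t (inj₁ (xy , yz , xz)) (inj₂ (inj₂ (tx , _ , tz))) =
    inj₂ (Alt-1st-3rd _ (≢-sym y≢t) tx tz xy xz yz)
  cyclic-trans x∈w y≢t (inj₂ (inj₁ (yz , zx , yx))) (inj₂ (inj₁ (zt , tx , _))) =
    inj₁ (Alt-1st-3rd _ y≢t yz yx zt zx tx)
  cyclic-trans x∈w y≢t (inj₂ (inj₂ (zx , xy , zy))) (inj₂ (inj₁ (zt , tx , _))) =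
    inj₂ (Alt-2nd-4th _ (≢-sym y≢t) zt zx zy tx xy)
  cyclic-trans x∈w y≢t (inj₁ (_ , _ , xz)) (inj₂ (inj₁ (_ , _ , zx))) = ⊥-elim (Alt-asym x∈w xz zx)
  cyclic-trans x∈w y≢t (inj₂ (inj₁ (_ , zx , _))) (inj₁ (xz , _))            = ⊥-elim (Alt-asym x∈w xz zx)
  cyclic-trans x∈w y≢t (inj₂ (inj₁ (_ , zx , _))) (inj₂ (inj₂ (_ , xz , _))) = ⊥-elim (Alt-asym x∈w xz zx)
  cyclic-trans x∈w y≢t (inj₂ (inj₂ (zx , _))) (inj₁ (xz , _))                = ⊥-elim (Alt-asym x∈w xz zx)
  cyclic-trans x∈w y≢t (inj₂ (inj₂ (zx , _))) (inj₂ (inj₂ (_ , xz , _)))     = ⊥-elim (Alt-asym x∈w xz zx)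

-- Odd wheels as obstructions

nextMod? : ∀ m i j → Dec (NextMod m i j)
nextMod? m i j = (toℕ j ℕ.≟ suc (toℕ i)) ⊎-dec ((toℕ j ℕ.≟ 0) ×-dec (suc (toℕ i) ℕ.≟ m))

wheelAdj? : ∀ k a b → Dec (WheelAdj k a b)
wheelAdj? k fzero    fzero    = no λ ()
wheelAdj? k fzero    (fsuc j) = yes (hub-rim j)
wheelAdj? k (fsuc i) fzero    = yes (rim-hub i)
wheelAdj? k (fsuc i) (fsuc j) =
  map′ [ rim-fwd i j , rim-bwd i j ]′
       (λ { (rim-fwd _ _ p) → inj₁ p ; (rim-bwd _ _ p) → inj₂ p })
       (nextMod? k i j ⊎-dec nextMod? k j i)

module _ {V : Set} (_≟_ : DecidableEquality V) {Adj : V → V → Set}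
         (representable : WordRepresentable V _≟_ Adj) where

  open Alternation _≟_

  private
    w        = proj₁ representable
    complete = proj₁ (proj₂ representable)
    correct  = proj₂ (proj₂ representable)

  -- The successor on the rim is a parameter, so that for a concrete `k` all side conditions are
  -- settled by computation.
  module _ (k : ℕ) (W : InducedSubgraph (suc k) (WheelAdj k) V Adj) (nxt : Fin k → Fin k)
           (nxt-correct : ∀ i → NextMod k i (nxt i)) (nxt-irrefl : ∀ i → i ≢ nxt i)
           (nxt²-irrefl : ∀ i → i ≢ nxt (nxt i))
           (chordless : ∀ i → ¬ WheelAdj k (fsuc i) (fsuc (nxt (nxt i)))) where

    private
      f   = proj₁ W
      hub = f fzero
      rim : Fin k → V
      rim i = f (fsuc i)

    alternating : ∀ {a b} → a ≢ b → WheelAdj k a b → Alt (f a) (f b) w ⊎ Alt (f b) (f a) w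
    alternating {a} {b} a≢b p =
      Alternate⇒Alt fa≢fb w (from (correct _ _ fa≢fb) (to (proj₂ (proj₂ W) a b a≢b) p))
      where fa≢fb = λ e → a≢b (proj₁ (proj₂ W) a b e)

    not-alternating : ∀ i → ¬ (Alt (rim i) (rim (nxt (nxt i))) w ⊎ Alt (rim (nxt (nxt i))) (rim i) w)
    not-alternating i p =
      chordless i (from (proj₂ (proj₂ W) _ _ i≢i″) (to (correct _ _ fi≢fi″) (Alt⇒Alternate fi≢fi″ p)))
      where i≢i″ = λ e → nxt²-irrefl i (Fin.suc-injective e)
            fi≢fi″ = λ e → i≢i″ (proj₁ (proj₂ W) _ _ e)

    rim-orientation : ∀ i → Cyclic hub (rim i) (rim (nxt i)) w ⊎ Cyclic hub (rim (nxt i)) (rim i) w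
    rim-orientation i = cyclic-cases (complete hub)
      (alternating (λ ()) (hub-rim i))
      (alternating (λ e → nxt-irrefl i (Fin.suc-injective e)) (rim-fwd i (nxt i) (nxt-correct i)))
      (alternating (λ ()) (hub-rim (nxt i)))

    private
      clockwise : Fin k → Bool
      clockwise i = [ (λ _ → true) , (λ _ → false) ]′ (rim-orientation i)

    -- The neighbourhood of the hub is transitively oriented and the rim has no chords,
    -- so every rim vertex is a source or a sink.
    clockwise-nxt : ∀ i → clockwise (nxt i) ≡ not (clockwise i)
    clockwise-nxt i with rim-orientation i | rim-orientation (nxt i)
    ... | inj₁ p | inj₁ q = ⊥-elim (not-alternating i (cyclic-trans (complete hub) rim≢ p q))
      where rim≢ = λ e → nxt²-irrefl i (Fin.suc-injective (proj₁ (proj₂ W) _ _ e))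
    ... | inj₁ _ | inj₂ _ = refl
    ... | inj₂ _ | inj₁ _ = refl
    ... | inj₂ p | inj₂ q = ⊥-elim (not-alternating i (swap (cyclic-trans (complete hub) rim≢ q p)))
      where rim≢ = λ e → nxt²-irrefl i (Fin.suc-injective (proj₁ (proj₂ W) _ _ (sym e)))

    rim-2-colouring : ∃ λ (δ : Fin k → Bool) → ∀ i → δ (nxt i) ≡ not (δ i)
    rim-2-colouring = clockwise , clockwise-nxt

  private
    fold-not : ∀ {k} {nxt : Fin k → Fin k} {δ : Fin k → Bool} → (∀ i → δ (nxt i) ≡ not (δ i)) →
               ∀ i t → δ (fold i nxt t) ≡ fold (δ i) not t
    fold-not flips i zero    = refl
    fold-not flips i (suc t) = trans (flips _) (cong not (fold-not flips i t))

    nxt₅ : Fin 5 → Fin 5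
    nxt₅ i = suc (toℕ i) mod 5

    nxt₇ : Fin 7 → Fin 7
    nxt₇ i = suc (toℕ i) mod 7

  no-W₅ : ¬ InducedSubgraph 6 (WheelAdj 5) V Adj
  no-W₅ W with rim-2-colouring 5 W nxt₅
                 (from-yes (Fin.all? λ i → nextMod? 5 i (nxt₅ i)))
                 (from-yes (Fin.all? λ i → ¬? (i Fin.≟ nxt₅ i)))
                 (from-yes (Fin.all? λ i → ¬? (i Fin.≟ nxt₅ (nxt₅ i))))
                 (from-yes (Fin.all? λ i → ¬? (wheelAdj? 5 (fsuc i) (fsuc (nxt₅ (nxt₅ i))))))
  -- Five successors compute back to `fzero`, while five negations amount to one.
  ... | δ , flips = Bool.not-¬ {δ fzero} refl (trans (fold-not flips fzero 5)
                      (trans (Bool.not-involutive _) (Bool.not-involutive _)))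

  no-W₇ : ¬ InducedSubgraph 8 (WheelAdj 7) V Adj
  no-W₇ W with rim-2-colouring 7 W nxt₇
                 (from-yes (Fin.all? λ i → nextMod? 7 i (nxt₇ i)))
                 (from-yes (Fin.all? λ i → ¬? (i Fin.≟ nxt₇ i)))
                 (from-yes (Fin.all? λ i → ¬? (i Fin.≟ nxt₇ (nxt₇ i))))
                 (from-yes (Fin.all? λ i → ¬? (wheelAdj? 7 (fsuc i) (fsuc (nxt₇ (nxt₇ i))))))
  ... | δ , flips = Bool.not-¬ {δ fzero} refl (trans (fold-not flips fzero 7)
                      (trans (Bool.not-involutive _) (trans (Bool.not-involutive _) (Bool.not-involutive _))))

-- Words from 4-colourings

filter-comm : ∀ {A : Set} {P Q : A → Set} (P? : Decidable P) (Q? : Decidable Q) xs →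
              filter P? (filter Q? xs) ≡ filter Q? (filter P? xs)
filter-comm P? Q? [] = refl
filter-comm P? Q? (x ∷ xs) with does (P? x) in p | does (Q? x) in q
... | true  | true  rewrite p | q = cong (x ∷_) (filter-comm P? Q? xs)
... | true  | false rewrite q = filter-comm P? Q? xs
... | false | true  rewrite p = filter-comm P? Q? xs
... | false | false = filter-comm P? Q? xs

pick : ∀ {A : Set} → A → A → Bool → Bool → List A
pick u v false false = []
pick u v false true  = v ∷ []
pick u v true  false = u ∷ []
pick u v true  true  = u ∷ v ∷ []

filter-pair : ∀ {A : Set} (S : A → Bool) u v → filterᵇ S (u ∷ v ∷ []) ≡ pick u v (S u) (S v)
filter-pair S u v with S u | S v in Sv
... | false | false rewrite Sv = refl
... | false | true  rewrite Sv = refl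
... | true  | false rewrite Sv = refl
... | true  | true  rewrite Sv = refl

NoConsecRepeat-++ˡ : ∀ {V : Set} (u : List V) {v} → NoConsecRepeat (u ++ v) → NoConsecRepeat u
NoConsecRepeat-++ˡ []          _          = nil
NoConsecRepeat-++ˡ (x ∷ [])    _          = one x
NoConsecRepeat-++ˡ (x ∷ y ∷ u) (cons n p) = cons n (NoConsecRepeat-++ˡ (y ∷ u) p)

NoConsecRepeat-++ʳ : ∀ {V : Set} (u : List V) {v} → NoConsecRepeat (u ++ v) → NoConsecRepeat v
NoConsecRepeat-++ʳ []          p            = p
NoConsecRepeat-++ʳ (x ∷ [])    (one _)      = nil
NoConsecRepeat-++ʳ (x ∷ [])    (cons _ p)   = p
NoConsecRepeat-++ʳ (x ∷ y ∷ u) (cons _ p) = NoConsecRepeat-++ʳ (y ∷ u) p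

-- The words `(uv)^k`. Unlike alternating words, they are closed under concatenation.
data Power {V : Set} (u v : V) : List V → Set where
  []  : Power u v []
  uv∷ : ∀ {w} → Power u v w → Power u v (u ∷ v ∷ w)

Power-++ : ∀ {V : Set} {u v : V} {w w′} → Power u v w → Power u v w′ → Power u v (w ++ w′)
Power-++ []      q = q
Power-++ (uv∷ p) q = uv∷ (Power-++ p q)

Power⇒NoConsecRepeat : ∀ {V : Set} {u v : V} → u ≢ v → ∀ {w} → Power u v w → NoConsecRepeat w
Power⇒NoConsecRepeat u≢v []            = nil
Power⇒NoConsecRepeat u≢v (uv∷ [])      = cons u≢v (one _)
Power⇒NoConsecRepeat u≢v (uv∷ (uv∷ p)) = cons u≢v (cons (≢-sym u≢v) (Power⇒NoConsecRepeat u≢v (uv∷ p)))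

unique-pair : ∀ {V : Set} {u v : V} {ys} → u ≢ v → Unique ys → (∀ {z} → z ∈ ys → z ≡ u ⊎ z ≡ v) →
              u ∈ ys → v ∈ ys → ys ≡ u ∷ v ∷ [] ⊎ ys ≡ v ∷ u ∷ []
unique-pair u≢v _ _ (here refl) (here refl) = ⊥-elim (u≢v refl)
unique-pair {ys = _ ∷ b ∷ []} u≢v _ _ (here refl) (there (here refl)) = inj₁ refl
unique-pair {ys = _ ∷ b ∷ []} u≢v _ _ (there (here refl)) (here refl) = inj₂ refl
unique-pair {ys = _ ∷ b ∷ []} u≢v _ _ (there (here refl)) (there (here refl)) = ⊥-elim (u≢v refl)
unique-pair {ys = a ∷ b ∷ c ∷ ys} u≢v ((a≢b ∷ a≢c ∷ _) ∷ (b≢c ∷ _) ∷ _) only _ _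
  with only (here refl) | only (there (here refl)) | only (there (there (here refl)))
... | inj₁ refl | inj₁ refl | _         = ⊥-elim (a≢b refl)
... | inj₂ refl | inj₂ refl | _         = ⊥-elim (a≢b refl)
... | inj₁ refl | inj₂ _    | inj₁ refl = ⊥-elim (a≢c refl)
... | inj₂ refl | inj₁ _    | inj₂ refl = ⊥-elim (a≢c refl)
... | inj₁ _    | inj₂ refl | inj₂ refl = ⊥-elim (b≢c refl)
... | inj₂ _    | inj₁ refl | inj₁ refl = ⊥-elim (b≢c refl)

next : Fin 4 → Fin 4
next fzero                      = fsuc fzero
next (fsuc fzero)               = fsuc (fsuc fzero)
next (fsuc (fsuc fzero))        = fsuc (fsuc (fsuc fzero))
next (fsuc (fsuc (fsuc fzero))) = fzero

-- The four values can only be 0, 1, 2, 3, and `next` leads from 3 back to 0.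
ascending : ∀ (a b c d : Fin 4) → toℕ a < toℕ b → toℕ b < toℕ c → toℕ c < toℕ d →
            b ≡ next a × c ≡ next b × d ≡ next c × a ≡ next d
ascending = from-yes (Fin.all? λ a → Fin.all? λ b → Fin.all? λ c → Fin.all? λ d →
  (toℕ a ℕ.<? toℕ b) →-dec ((toℕ b ℕ.<? toℕ c) →-dec ((toℕ c ℕ.<? toℕ d) →-dec
  ((b Fin.≟ next a) ×-dec ((c Fin.≟ next b) ×-dec ((d Fin.≟ next c) ×-dec (a Fin.≟ next d)))))))

-- The orientation by levels and its word

module FourColouring
  {V : Set} (_≟_ : DecidableEquality V)
  (Adj : V → V → Set) (adj? : ∀ u v → Dec (Adj u v)) (adj-sym : ∀ {u v} → Adj u v → Adj v u)
  (vs : List V) (vs-unique : Unique vs) (vs-complete : ∀ v → v ∈ vs)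
  (colour : V → Fin 4) (proper : ∀ {u v} → Adj u v → colour u ≢ colour v)
  (no-rainbow : ∀ {a b c d} → Adj a b → Adj b c → Adj c d → Adj d a →
    colour b ≡ next (colour a) → colour c ≡ next (colour b) →
    colour d ≡ next (colour c) → colour a ≡ next (colour d) → ⊥)
  where

  open Alternation _≟_

  level : V → ℕ
  level v = toℕ (colour v)

  _⟶_ : V → V → Set
  u ⟶ v = Adj u v × level u < level v

  _⟶*_ : V → V → Set
  _⟶*_ = Star _⟶_

  orient : ∀ {u v} → Adj u v → (u ⟶ v) ⊎ (v ⟶ u)
  orient {u} {v} p with ℕ.<-cmp (level u) (level v)
  ... | tri< l _ _ = inj₁ (p , l)
  ... | tri≈ _ e _ = ⊥-elim (proper p (Fin.toℕ-injective e))
  ... | tri> _ _ g = inj₂ (adj-sym p , g)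

  ⟶*-level : ∀ {u v} → u ⟶* v → level u ≤ level v
  ⟶*-level ε             = ℕ.≤-refl
  ⟶*-level ((_ , l) ◅ p) = ℕ.≤-trans (ℕ.<⇒≤ l) (⟶*-level p)

  ⟶*-antisym : ∀ {u v} → u ⟶* v → v ⟶* u → u ≡ v
  ⟶*-antisym ε             _ = refl
  ⟶*-antisym ((_ , l) ◅ p) q = ⊥-elim (ℕ.<-irrefl refl (ℕ.<-≤-trans l (⟶*-level (p ◅◅ q))))

  -- `k` bounds the length of the remaining search: every arrow raises the level, so spending one
  -- unit of `k` keeps the sum at least 4.
  reach-within? : ∀ k u v → 4 ≤ k + level u → Dec (u ⟶* v)
  reach-within? zero u v 4≤ = ⊥-elim (ℕ.<⇒≱ (Fin.toℕ<n (colour u)) 4≤)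
  reach-within? (suc k) u v 4≤ with u ≟ v
  ... | yes refl = yes ε
  ... | no u≢v   = map′ (λ p → let (z , _ , e , q) = find {P = λ z → u ⟶ z × z ⟶* v} p in e ◅ q)
                        (λ { ε → ⊥-elim (u≢v refl) ; (_◅_ {j = z} e q) → lose (vs-complete z) (e , q) })
                        (any? via? vs)
    where
    via? : ∀ z → Dec (u ⟶ z × z ⟶* v)
    via? z with adj? u z ×-dec (level u ℕ.<? level z)
    ... | no ¬e  = no λ (e , _) → ¬e e
    ... | yes e = map′ (e ,_) proj₂ (reach-within? k z v
                    (ℕ.≤-trans 4≤ (ℕ.≤-trans (ℕ.≤-reflexive (sym (ℕ.+-suc k _))) (ℕ.+-monoʳ-≤ k (proj₂ e)))))

  -- Opaque, so that the case splits below meet `reach?` itself and not its unfolded search.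
  abstract
    reach? : ∀ u v → Dec (u ⟶* v)
    reach? u v = reach-within? 4 u v (ℕ.m≤m+n 4 _)

  -- `a`, `b`, `c`, `d`, `e` would need five different levels. The intermediate paths make the lemma
  -- cover all longer paths.
  no-4-arrows : ∀ {a b b′ c c′ d d′ e} →
    a ⟶ b → b ⟶* b′ → b′ ⟶ c → c ⟶* c′ → c′ ⟶ d → d ⟶* d′ → d′ ⟶ e → ⊥
  no-4-arrows {a} {b} {b′} {c} {c′} {d} {d′} {e} (_ , ab) bb′ (_ , b′c) cc′ (_ , c′d) dd′ (_ , d′e) =
    ℕ.<⇒≱ (Fin.toℕ<n (colour e)) (begin
      4            ≤⟨ ℕ.m≤m+n 4 (level a) ⟩
      4 + level a  ≤⟨ ℕ.+-monoʳ-≤ 3 (ℕ.≤-trans ab (⟶*-level bb′)) ⟩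
      3 + level b′ ≤⟨ ℕ.+-monoʳ-≤ 2 (ℕ.≤-trans b′c (⟶*-level cc′)) ⟩
      2 + level c′ ≤⟨ ℕ.+-monoʳ-≤ 1 (ℕ.≤-trans c′d (⟶*-level dd′)) ⟩
      1 + level d′ ≤⟨ d′e ⟩
      level e      ∎)
    where open ℕ.≤-Reasoning

  -- Three arrows run through all four levels, so the edge would close a 4-cycle coloured 0, 1, 2,
  -- 3.
  no-shortcut₃ : ∀ {a b c d} → a ⟶ b → b ⟶ c → c ⟶ d → ¬ Adj a d
  no-shortcut₃ (ab , p) (bc , q) (cd , r) ad with ascending _ _ _ _ p q r
  ... | e , f , g , h = no-rainbow ab bc cd (adj-sym ad) e f g h

  -- Being distinct and non-adjacent, `x` and `y` are at least two arrows apart. If the whole path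
  -- has two arrows, it joins `x` to `y`; three arrows fall under `no-shortcut₃`, and more are
  -- impossible.
  no-shortcut : ∀ {u x y v} → u ⟶* x → x ⟶* y → y ⟶* v → x ≢ y → ¬ Adj x y → ¬ Adj u v
  no-shortcut _ ε _ x≢y _ = ⊥-elim (x≢y refl)
  no-shortcut _ ((e , _) ◅ ε) _ _ ¬xy = ⊥-elim (¬xy e)
  no-shortcut ε _ ε _ ¬xy = ¬xy
  no-shortcut ε             (a ◅ b ◅ ε)     (c ◅ ε)     _ _ = no-shortcut₃ a b c
  no-shortcut (a ◅ ε)       (b ◅ c ◅ ε)     ε           _ _ = no-shortcut₃ a b c
  no-shortcut ε           (a ◅ b ◅ ε)     (c ◅ d ◅ _) _ _ = ⊥-elim (no-4-arrows a ε b ε c ε d)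
  no-shortcut ε           (a ◅ b ◅ c ◅ p) (d ◅ _)     _ _ = ⊥-elim (no-4-arrows a ε b ε c p d)
  no-shortcut (a ◅ ε)     (b ◅ c ◅ d ◅ _) ε           _ _ = ⊥-elim (no-4-arrows a ε b ε c ε d)
  no-shortcut (a ◅ p)     (b ◅ c ◅ q)     (d ◅ _)     _ _ = ⊥-elim (no-4-arrows a p b ε c q d)
  no-shortcut (a ◅ b ◅ p) (c ◅ d ◅ _)     _           _ _ = ⊥-elim (no-4-arrows a ε b p c ε d)

  private
    levelOrder : DecTotalOrder _ _ _
    levelOrder = On.decTotalOrder ℕ.≤-decTotalOrder level

    module Sort = Data.List.Sort levelOrder

  -- Sorting by level yields a topological order of the arrows.
  order : List V
  order = Sort.sort vs

  order-complete : ∀ v → v ∈ order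
  order-complete v = ∈-resp-↭ (↭-sym (Sort.sort-↭ vs)) (vs-complete v)

  order-unique : Unique order
  order-unique = Permutationₛ.Unique-resp-↭ (setoid V) (↭⇒↭ₛ (↭-sym (Sort.sort-↭ vs))) vs-unique

  order-sorted : AllPairs (λ u v → level u ≤ level v) order
  order-sorted = Sorted⇒AllPairs (DecTotalOrder.totalOrder levelOrder) (Sort.sort-↗ vs)

  module _ {u v : V} where

    pair? : ∀ z → Dec (z ≡ u ⊎ z ≡ v)
    pair? z = (z ≟ u) ⊎-dec (z ≟ v)

    restrict-order : u ≢ v → Restrict u v order ≡ u ∷ v ∷ [] ⊎ Restrict u v order ≡ v ∷ u ∷ []
    restrict-order u≢v = unique-pair u≢v (Unique.filter⁺ pair? order-unique)
      (λ z∈ → proj₂ (∈-filter⁻ pair? {xs = order} z∈))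
      (∈-filter⁺ pair? (order-complete u) (inj₁ refl))
      (∈-filter⁺ pair? (order-complete v) (inj₂ refl))

    restrict-order-⟶ : u ⟶ v → Restrict u v order ≡ u ∷ v ∷ []
    restrict-order-⟶ (_ , l) with restrict-order (λ { refl → ℕ.<-irrefl refl l })
    ... | inj₁ e = e
    ... | inj₂ e with subst (AllPairs _) e (AllPairs.filter⁺ pair? order-sorted)
    ...   | (l′ ∷ []) ∷ _ = ⊥-elim (ℕ.<⇒≱ l l′)

  block : (V → Bool) → List V
  block S = filterᵇ S order

  restrict-block : ∀ {u v a b} → Restrict u v order ≡ a ∷ b ∷ [] → ∀ S →
                   Restrict u v (block S) ≡ pick a b (S a) (S b)
  restrict-block e S =
    trans (filter-comm pair? (λ z → T? (S z)) order) (trans (cong (filterᵇ S) e) (filter-pair S _ _))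

  restrict-block-fst : ∀ {u v} → u ≢ v → ∀ S → S u ≡ true → S v ≡ false → Restrict u v (block S) ≡ u ∷ []
  restrict-block-fst {u} {v} u≢v S Su Sv with restrict-order u≢v
  ... | inj₁ e = trans (restrict-block e S) (cong₂ (pick u v) Su Sv)
  ... | inj₂ e = trans (restrict-block e S) (cong₂ (pick v u) Sv Su)

  restrict-block-snd : ∀ {u v} → u ≢ v → ∀ S → S u ≡ false → S v ≡ true → Restrict u v (block S) ≡ v ∷ []
  restrict-block-snd {u} {v} u≢v S Su Sv with restrict-order u≢v
  ... | inj₁ e = trans (restrict-block e S) (cong₂ (pick u v) Su Sv)
  ... | inj₂ e = trans (restrict-block e S) (cong₂ (pick v u) Sv Su)

  blocks : List (V → Bool) → List V
  blocks = concatMap block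

  restrict-blocks-⟶ : ∀ {u v} → u ⟶ v → ∀ Ss →
    Restrict u v (blocks Ss) ≡ concatMap (λ S → pick u v (S u) (S v)) Ss
  restrict-blocks-⟶ e []       = refl
  restrict-blocks-⟶ e (S ∷ Ss) = trans (filter-++ _ (block S) (blocks Ss))
    (cong₂ _++_ (restrict-block (restrict-order-⟶ e) S) (restrict-blocks-⟶ e Ss))

  above below : V → V → Bool
  above y z = does (reach? y z)
  below x z = does (reach? z x)

  -- Reads x twice before y; the alternation of an arrow u ⟶ v could only break if u is
  -- below x and v is above y, that is, if u ⟶ v were a shortcut.
  comparable-word : V → V → List V
  comparable-word x y = blocks (not ∘ above y ∷ below x ∷ above y ∷ not ∘ below x ∷ [])

  -- Two topological orders, of which the first reads x before y and the second y before x.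
  incomparable-word : V → V → List V
  incomparable-word x y = blocks (not ∘ above y ∷ above y ∷ not ∘ above x ∷ above x ∷ [])

  comparable-arrows : ∀ {x y} → x ≢ y → ¬ Adj x y → x ⟶* y → ∀ {u v} → u ⟶ v →
                      Power u v (Restrict u v (comparable-word x y))
  comparable-arrows {x} {y} x≢y ¬xy xy {u} {v} e
    rewrite restrict-blocks-⟶ e (not ∘ above y ∷ below x ∷ above y ∷ not ∘ below x ∷ [])
    with reach? y u | reach? y v | reach? u x | reach? v x
  -- The first two cases contradict that `above y` is closed upwards and `below x` downwards; the
  -- third is a shortcut.
  ... | yes yu | no ¬yv | _      | _      = ⊥-elim (¬yv (yu ◅◅ e ◅ ε))
  ... | _      | _      | no ¬ux | yes vx = ⊥-elim (¬ux (e ◅ vx))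
  ... | _      | yes yv | yes ux | _      = ⊥-elim (no-shortcut ux xy yv x≢y ¬xy (proj₁ e))
  ... | no _   | no _   | no _   | no _   = uv∷ (uv∷ [])
  ... | no _   | no _   | yes _  | no _   = uv∷ (uv∷ [])
  ... | no _   | no _   | yes _  | yes _  = uv∷ (uv∷ [])
  ... | no _   | yes _  | no _   | no _   = uv∷ (uv∷ [])
  ... | yes _  | yes _  | no _   | no _   = uv∷ (uv∷ [])

  incomparable-arrows : ∀ x y {u v} → u ⟶ v → Power u v (Restrict u v (incomparable-word x y))
  incomparable-arrows x y {u} {v} e
    rewrite restrict-blocks-⟶ e (not ∘ above y ∷ above y ∷ not ∘ above x ∷ above x ∷ [])
    with reach? y u | reach? y v | reach? x u | reach? x v
  ... | yes yu | no ¬yv | _      | _      = ⊥-elim (¬yv (yu ◅◅ e ◅ ε))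
  ... | _      | _      | yes xu | no ¬xv = ⊥-elim (¬xv (xu ◅◅ e ◅ ε))
  ... | no _   | no _   | no _   | no _   = uv∷ (uv∷ [])
  ... | no _   | no _   | no _   | yes _  = uv∷ (uv∷ [])
  ... | no _   | no _   | yes _  | yes _  = uv∷ (uv∷ [])
  ... | no _   | yes _  | no _   | no _   = uv∷ (uv∷ [])
  ... | no _   | yes _  | no _   | yes _  = uv∷ (uv∷ [])
  ... | no _   | yes _  | yes _  | yes _  = uv∷ (uv∷ [])
  ... | yes _  | yes _  | no _   | no _   = uv∷ (uv∷ [])
  ... | yes _  | yes _  | no _   | yes _  = uv∷ (uv∷ [])
  ... | yes _  | yes _  | yes _  | yes _  = uv∷ (uv∷ [])

  -- The first two blocks contain `x` but not `y`.
  comparable-breaks : ∀ {x y} → x ≢ y → x ⟶* y → ¬ Alternate _≟_ x y (comparable-word x y)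
  comparable-breaks {x} {y} x≢y xy p
    rewrite filter-++ (pair? {x} {y}) (block (not ∘ above y)) (blocks (below x ∷ above y ∷ not ∘ below x ∷ []))
          | filter-++ (pair? {x} {y}) (block (below x)) (blocks (above y ∷ not ∘ below x ∷ []))
          | restrict-block-fst x≢y (not ∘ above y)
              (cong not (dec-false (reach? y x) (λ yx → x≢y (⟶*-antisym xy yx))))
              (cong not (dec-true (reach? y y) ε))
          | restrict-block-fst x≢y (below x) (dec-true (reach? x x) ε)
              (dec-false (reach? y x) (λ yx → x≢y (⟶*-antisym xy yx)))
    with p
  ... | cons x≢x _ = x≢x refl

  -- The first three blocks restrict to `x`, `y`, `y`.
  incomparable-breaks : ∀ {x y} → x ≢ y → ¬ x ⟶* y → ¬ y ⟶* x → ¬ Alternate _≟_ x y (incomparable-word x y)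
  incomparable-breaks {x} {y} x≢y ¬xy ¬yx p
    rewrite filter-++ (pair? {x} {y}) (block (not ∘ above y)) (blocks (above y ∷ not ∘ above x ∷ above x ∷ []))
          | filter-++ (pair? {x} {y}) (block (above y)) (blocks (not ∘ above x ∷ above x ∷ []))
          | filter-++ (pair? {x} {y}) (block (not ∘ above x)) (blocks (above x ∷ []))
          | restrict-block-fst x≢y (not ∘ above y)
              (cong not (dec-false (reach? y x) ¬yx)) (cong not (dec-true (reach? y y) ε))
          | restrict-block-snd x≢y (above y) (dec-false (reach? y x) ¬yx) (dec-true (reach? y y) ε)
          | restrict-block-snd x≢y (not ∘ above x)
              (cong not (dec-true (reach? x x) ε)) (cong not (dec-false (reach? x y) ¬xy))
    with p
  ... | cons _ (cons y≢y _) = y≢y refl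

  gadget : V × V → List V
  gadget (x , y) with ¬? (x ≟ y) ×-dec ¬? (adj? x y) ×-dec reach? x y
  ... | yes _ = comparable-word x y
  -- Equal and adjacent pairs end here too, which is harmless: `incomparable-arrows` holds for all
  -- pairs.
  ... | no  _ = incomparable-word x y

  gadget-arrows : ∀ xy {u v} → u ⟶ v → Power u v (Restrict u v (gadget xy))
  gadget-arrows (x , y) e with ¬? (x ≟ y) ×-dec ¬? (adj? x y) ×-dec reach? x y
  ... | yes (x≢y , ¬xy , xy) = comparable-arrows x≢y ¬xy xy e
  ... | no  _                = incomparable-arrows x y e

  -- If `y` reaches `x`, the gadget of the reversed pair does this work.
  gadget-breaks : ∀ {x y} → x ≢ y → ¬ Adj x y → ¬ y ⟶* x → ¬ Alternate _≟_ x y (gadget (x , y))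
  gadget-breaks {x} {y} x≢y ¬xy ¬yx with ¬? (x ≟ y) ×-dec ¬? (adj? x y) ×-dec reach? x y
  ... | yes (_ , _ , xy) = comparable-breaks x≢y xy
  ... | no  ¬p           = incomparable-breaks x≢y (λ xy → ¬p (x≢y , ¬xy , xy)) ¬yx

  word : List V
  word = order ++ concatMap gadget (cartesianProduct vs vs)

  word-arrows : ∀ {u v} → u ⟶ v → Power u v (Restrict u v word)
  word-arrows {u} {v} e
    rewrite filter-++ (pair? {u} {v}) order (concatMap gadget (cartesianProduct vs vs)) | restrict-order-⟶ e
    = uv∷ (all-gadgets (cartesianProduct vs vs))
    where
    all-gadgets : ∀ xys → Power u v (Restrict u v (concatMap gadget xys))
    all-gadgets []         = []
    all-gadgets (xy ∷ xys) rewrite filter-++ (pair? {u} {v}) (gadget xy) (concatMap gadget xys) =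
      Power-++ (gadget-arrows xy e) (all-gadgets xys)

  -- Alternation passes to factors of a word.
  alternate-gadget : ∀ {x y} xys {xy} → xy ∈ xys →
                     Alternate _≟_ x y (concatMap gadget xys) → Alternate _≟_ x y (gadget xy)
  alternate-gadget {x} {y} (xy ∷ xys) i p
    rewrite filter-++ (pair? {x} {y}) (gadget xy) (concatMap gadget xys)
    with i
  ... | here refl = NoConsecRepeat-++ˡ _ p
  ... | there j   = alternate-gadget xys j (NoConsecRepeat-++ʳ (Restrict x y (gadget xy)) p)

  word-breaks : ∀ {x y} → x ≢ y → ¬ Adj x y → ¬ y ⟶* x → ¬ Alternate _≟_ x y word
  word-breaks {x} {y} x≢y ¬xy ¬yx p =
    gadget-breaks x≢y ¬xy ¬yx
      (alternate-gadget (cartesianProduct vs vs) (∈-cartesianProduct⁺ (vs-complete x) (vs-complete y))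
        (NoConsecRepeat-++ʳ (Restrict x y order) (subst NoConsecRepeat (filter-++ pair? order _) p)))

  wordRepresentable : WordRepresentable V _≟_ Adj
  wordRepresentable = word , (λ x → ∈-++⁺ˡ (order-complete x)) , λ x y x≢y → mk⇔ (edge x≢y) (alternates x≢y)
    where
    alternates : ∀ {x y} → x ≢ y → Adj x y → Alternate _≟_ x y word
    alternates x≢y p with orient p
    ... | inj₁ e = Power⇒NoConsecRepeat x≢y (word-arrows e)
    ... | inj₂ e = Alternate-sym (≢-sym x≢y) word (Power⇒NoConsecRepeat (≢-sym x≢y) (word-arrows e))

    edge : ∀ {x y} → x ≢ y → Alternate _≟_ x y word → Adj x y
    edge {x} {y} x≢y p with adj? x y
    ... | yes xy = xy
    ... | no ¬xy with reach? y x
    ...   | no ¬yx = ⊥-elim (word-breaks x≢y ¬xy ¬yx p)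
    ...   | yes yx = ⊥-elim (word-breaks (≢-sym x≢y) (λ e → ¬xy (adj-sym e))
                      (λ xy → x≢y (⟶*-antisym xy yx)) (Alternate-sym x≢y word p))

-- Interior vertices of odd degree

data Steps (m : ℕ) : ℕ → Fin m → Fin m → Set where
  []  : ∀ {j} → Steps m 0 j j
  _∷_ : ∀ {t j j′ j″} → NextMod m j j′ → Steps m t j′ j″ → Steps m (suc t) j j″

-- `k` counts the passages from the last sector to sector 0.
steps-winding : ∀ {m t j j′} → Steps m t j j′ → ∃ λ k → t + toℕ j ≡ toℕ j′ + k * m
steps-winding [] = 0 , sym (ℕ.+-identityʳ _)
steps-winding {m} {suc t} {j} {j′} (inj₁ e ∷ s) with steps-winding s
... | k , e′ = k , trans (trans (sym (ℕ.+-suc t (toℕ j))) (cong (t +_) (sym e))) e′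
steps-winding {m} {suc t} {j} {j′} (inj₂ (e , f) ∷ s) with steps-winding s
... | k , e′ = suc k , (begin
  suc t + toℕ j        ≡⟨ ℕ.+-suc t (toℕ j) ⟨
  t + suc (toℕ j)      ≡⟨ cong (t +_) f ⟩
  t + m                ≡⟨ cong (_+ m) (trans (sym (ℕ.+-identityʳ t)) (trans (cong (t +_) (sym e)) e′)) ⟩
  (toℕ j′ + k * m) + m ≡⟨ ℕ.+-assoc (toℕ j′) (k * m) m ⟩
  toℕ j′ + (k * m + m) ≡⟨ cong (toℕ j′ +_) (ℕ.+-comm (k * m) m) ⟩
  toℕ j′ + suc k * m   ∎)
  where open ≡-Reasoning

-- Without winding, the equation of `steps-winding` would make the length zero.
closed-steps : ∀ {m t j} → Steps m (suc t) j j → m ≤ suc t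
closed-steps {m} {t} {j} s with steps-winding s
... | k , e with k | ℕ.+-cancelʳ-≡ (toℕ j) (suc t) (k * m) (trans e (ℕ.+-comm (toℕ j) (k * m)))
...   | suc k′ | e′ = ℕ.≤-trans (ℕ.m≤m+n m (k′ * m)) (ℕ.≤-reflexive (sym e′))

nextMod-functional : ∀ {m j k l} → NextMod m j k → NextMod m j l → k ≡ l
nextMod-functional (inj₁ p) (inj₁ q) = Fin.toℕ-injective (trans p (sym q))
nextMod-functional {k = k} (inj₁ p) (inj₂ (_ , f)) = ⊥-elim (ℕ.<-irrefl (trans p f) (Fin.toℕ<n k))
nextMod-functional {l = l} (inj₂ (_ , f)) (inj₁ q) = ⊥-elim (ℕ.<-irrefl (trans q f) (Fin.toℕ<n l))
nextMod-functional (inj₂ (p , _)) (inj₂ (q , _)) = Fin.toℕ-injective (trans p (sym q))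

nextMod-injective : ∀ {m j k l} → NextMod m j l → NextMod m k l → j ≡ k
nextMod-injective (inj₁ p) (inj₁ q) = Fin.toℕ-injective (ℕ.suc-injective (trans (sym p) q))
nextMod-injective (inj₁ p) (inj₂ (q , _)) with () ← trans (sym p) q
nextMod-injective (inj₂ (p , _)) (inj₁ q) with () ← trans (sym q) p
nextMod-injective (inj₂ (_ , p)) (inj₂ (_ , q)) = Fin.toℕ-injective (ℕ.suc-injective (trans p (sym q)))

module Cycle {m : ℕ} (4≤m : 4 ≤ m) where

  no-1-cycle : ∀ {j} → ¬ NextMod m j j
  no-1-cycle p = ℕ.<⇒≱ (ℕ.≤-trans (s≤s (s≤s z≤n)) 4≤m) (closed-steps (p ∷ []))

  no-2-cycle : ∀ {j k} → NextMod m j k → ¬ NextMod m k j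
  no-2-cycle p q = ℕ.<⇒≱ (ℕ.≤-trans (s≤s (s≤s (s≤s z≤n))) 4≤m) (closed-steps (p ∷ q ∷ []))

  no-3-cycle : ∀ {j k l} → NextMod m j k → NextMod m k l → ¬ NextMod m l j
  no-3-cycle p q r = ℕ.<⇒≱ 4≤m (closed-steps (p ∷ q ∷ r ∷ []))

  4-cycle : ∀ {j k l o} → NextMod m j k → NextMod m k l → NextMod m l o → NextMod m o j → m ≡ 4
  4-cycle p q r s = ℕ.≤-antisym (closed-steps (p ∷ q ∷ r ∷ s ∷ [])) 4≤m

-- Positions in a 3 × 3 block of vertices of the grid.
Position : Set
Position = Fin 3 × Fin 3

-- A finite model of the triangulation around one interior vertex, in which wheels can be verified
-- by computation.
data PatchEdge (s : Fin 2 → Fin 2 → Bool) : Position → Position → Set where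
  horiz : ∀ i b → PatchEdge s (i , inject₁ b) (i , fsuc b)
  vert  : ∀ a j → PatchEdge s (inject₁ a , j) (fsuc a , j)
  diag₁ : ∀ a b → s a b ≡ true → PatchEdge s (inject₁ a , inject₁ b) (fsuc a , fsuc b)
  diag₂ : ∀ a b → s a b ≡ false → PatchEdge s (fsuc a , inject₁ b) (inject₁ a , fsuc b)

PatchAdj : (Fin 2 → Fin 2 → Bool) → Position → Position → Set
PatchAdj s p q = PatchEdge s p q ⊎ PatchEdge s q p

_≟P_ : (p q : Position) → Dec (p ≡ q)
_≟P_ = Product.≡-dec Fin._≟_ Fin._≟_

patchEdge? : ∀ s p q → Dec (PatchEdge s p q)
patchEdge? s p q = map′
  [ (λ { (i , b , refl , refl) → horiz i b })
  , [ (λ { (a , j , refl , refl) → vert a j })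
    , (λ { (a , b , inj₁ (t , refl , refl)) → diag₁ a b t ; (a , b , inj₂ (f , refl , refl)) → diag₂ a b f }) ]′ ]′
  (λ { (horiz i b) → inj₁ (i , b , refl , refl)
     ; (vert a j) → inj₂ (inj₁ (a , j , refl , refl))
     ; (diag₁ a b t) → inj₂ (inj₂ (a , b , inj₁ (t , refl , refl)))
     ; (diag₂ a b f) → inj₂ (inj₂ (a , b , inj₂ (f , refl , refl))) })
  ((Fin.any? λ i → Fin.any? λ b → (p ≟P (i , inject₁ b)) ×-dec (q ≟P (i , fsuc b)))
   ⊎-dec ((Fin.any? λ a → Fin.any? λ j → (p ≟P (inject₁ a , j)) ×-dec (q ≟P (fsuc a , j)))
   ⊎-dec (Fin.any? λ a → Fin.any? λ b →
     ((s a b Bool.≟ true) ×-dec (p ≟P (inject₁ a , inject₁ b)) ×-dec (q ≟P (fsuc a , fsuc b)))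
     ⊎-dec ((s a b Bool.≟ false) ×-dec (p ≟P (fsuc a , inject₁ b)) ×-dec (q ≟P (inject₁ a , fsuc b))))))

patchAdj? : ∀ s p q → Dec (PatchAdj s p q)
patchAdj? s p q = patchEdge? s p q ⊎-dec patchEdge? s q p

square : Bool → Bool → Bool → Bool → Fin 2 → Fin 2 → Bool
square a b c d 0F 0F = a
square a b c d 0F 1F = b
square a b c d 1F 0F = c
square a b c d 1F 1F = d

PatchWheel : ℕ → (Fin 2 → Fin 2 → Bool) → Set
PatchWheel k s = InducedSubgraph (suc k) (WheelAdj k) Position (PatchAdj s)

-- Both `True` arguments are evaluated, so listing the hub and then the rim in cyclic order
-- suffices.
patchWheel : ∀ k s (f : Vec Position (suc k)) →
  True (Fin.all? λ a → Fin.all? λ b → (lookup f a ≟P lookup f b) →-dec (a Fin.≟ b)) →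
  True (Fin.all? λ a → Fin.all? λ b → ¬? (a Fin.≟ b) →-dec
    ((wheelAdj? k a b →-dec patchAdj? s (lookup f a) (lookup f b)) ×-dec
     (patchAdj? s (lookup f a) (lookup f b) →-dec wheelAdj? k a b))) →
  PatchWheel k s
patchWheel k s f inj iff = lookup f , toWitness inj ,
  λ a b a≢b → let (i , j) = toWitness iff a b a≢b in mk⇔ i j

pattern N  = 0F , 1F
pattern NE = 0F , 2F
pattern E  = 1F , 2F
pattern SE = 2F , 2F
pattern S  = 2F , 1F
pattern SW = 2F , 0F
pattern W  = 1F , 0F
pattern NW = 0F , 0F
pattern O  = 1F , 1F

-- The diagonal of a cell passes through the centre of the patch iff its value is
-- a = true, b = false, c = false and d = true respectively.
odd-patch : ∀ a b c d → (a xor b) ≢ (c xor d) →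
  PatchWheel 5 (square a b c d) ⊎ PatchWheel 7 (square a b c d)
-- In the first four cases one diagonal passes through the centre, in the next four three, and in
-- the others an even number, against the hypothesis.
odd-patch true  true  true  false _ = inj₁ (patchWheel 5 _ (O ∷ N ∷ E ∷ S ∷ W ∷ NW ∷ []) _ _)
odd-patch false false true  false _ = inj₁ (patchWheel 5 _ (O ∷ N ∷ NE ∷ E ∷ S ∷ W ∷ []) _ _)
odd-patch false true  false false _ = inj₁ (patchWheel 5 _ (O ∷ N ∷ E ∷ S ∷ SW ∷ W ∷ []) _ _)
odd-patch false true  true  true  _ = inj₁ (patchWheel 5 _ (O ∷ N ∷ E ∷ SE ∷ S ∷ W ∷ []) _ _)
odd-patch true  false false false _ = inj₂ (patchWheel 7 _ (O ∷ N ∷ NE ∷ E ∷ S ∷ SW ∷ W ∷ NW ∷ []) _ _)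
odd-patch true  false true  true  _ = inj₂ (patchWheel 7 _ (O ∷ N ∷ NE ∷ E ∷ SE ∷ S ∷ W ∷ NW ∷ []) _ _)
odd-patch true  true  false true  _ = inj₂ (patchWheel 7 _ (O ∷ N ∷ E ∷ SE ∷ S ∷ SW ∷ W ∷ NW ∷ []) _ _)
odd-patch false false false true  _ = inj₂ (patchWheel 7 _ (O ∷ N ∷ NE ∷ E ∷ SE ∷ S ∷ SW ∷ W ∷ []) _ _)
odd-patch true  true  true  true  n = ⊥-elim (n refl)
odd-patch true  true  false false n = ⊥-elim (n refl)
odd-patch true  false true  false n = ⊥-elim (n refl)
odd-patch true  false false true  n = ⊥-elim (n refl)
odd-patch false true  true  false n = ⊥-elim (n refl)
odd-patch false true  false true  n = ⊥-elim (n refl)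
odd-patch false false true  true  n = ⊥-elim (n refl)
odd-patch false false false false n = ⊥-elim (n refl)

induced-trans : ∀ {h} {H : Fin h → Fin h → Set} {P V : Set} {R : P → P → Set} {Adj : V → V → Set}
  (e : P → V) → (∀ p q → e p ≡ e q → p ≡ q) → (∀ p q → R p q ⇔ Adj (e p) (e q)) →
  InducedSubgraph h H P R → InducedSubgraph h H V Adj
induced-trans e e-inj e-iff (f , f-inj , f-iff) =
  e ∘ f , (λ a b p → f-inj a b (e-inj _ _ p)) ,
  λ a b a≢b → mk⇔ (to (e-iff _ _) ∘ to (f-iff a b a≢b)) (from (f-iff a b a≢b) ∘ from (e-iff _ _))

-- The patch as an induced subgraph of the cylinder

module Patch {m n : ℕ} (4≤m : 4 ≤ m) (d : Triangulation m (suc n)) (c : Fin n)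
             (col : Fin 3 → Fin m)
             (col-next : ∀ b → NextMod m (col (inject₁ b)) (col (fsuc b))) where

  open Cycle 4≤m

  cell : Fin 2 → Fin (suc n)
  cell 0F = inject₁ c
  cell 1F = fsuc c

  row : Fin 3 → Fin (suc (suc n))
  row 0F = inject₁ (inject₁ c)
  row 1F = fsuc (inject₁ c)
  row 2F = fsuc (fsuc c)

  toℕ-row : ∀ x → toℕ (row x) ≡ toℕ x + toℕ c
  toℕ-row 0F = trans (Fin.toℕ-inject₁ _) (Fin.toℕ-inject₁ c)
  toℕ-row 1F = cong suc (Fin.toℕ-inject₁ c)
  toℕ-row 2F = refl

  row-inject₁ : ∀ a → row (inject₁ a) ≡ inject₁ (cell a)
  row-inject₁ 0F = refl
  row-inject₁ 1F = refl

  row-suc : ∀ a → row (fsuc a) ≡ fsuc (cell a)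
  row-suc 0F = refl
  row-suc 1F = refl

  row-injective : ∀ x y → row x ≡ row y → x ≡ y
  row-injective x y e = Fin.toℕ-injective (ℕ.+-cancelʳ-≡ (toℕ c) _ _
    (trans (sym (toℕ-row x)) (trans (cong toℕ e) (toℕ-row y))))

  split-step : ∀ (x y : Fin 3) → toℕ y ≡ suc (toℕ x) → ∃ λ a → x ≡ inject₁ a × y ≡ fsuc a
  split-step 0F 1F _ = 0F , refl , refl
  split-step 1F 2F _ = 1F , refl , refl

  row-step : ∀ k x y → inject₁ k ≡ row x → fsuc k ≡ row y →
             ∃ λ a → x ≡ inject₁ a × y ≡ fsuc a × k ≡ cell a
  row-step k x y p q with split-step x y (ℕ.+-cancelʳ-≡ (toℕ c) _ _
      (trans (sym (toℕ-row y)) (trans (cong toℕ (sym q))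
        (cong suc (trans (sym (Fin.toℕ-inject₁ k)) (trans (cong toℕ p) (toℕ-row x)))))))
  ... | a , refl , refl = a , refl , refl , Fin.suc-injective (trans q (row-suc a))

  -- As `m` is at least 4, the outer columns are not consecutive around the back of the cylinder.
  col-step : ∀ x y → NextMod m (col x) (col y) → ∃ λ b → x ≡ inject₁ b × y ≡ fsuc b
  col-step 0F 0F p = ⊥-elim (no-1-cycle p)
  col-step 0F 1F p = 0F , refl , refl
  col-step 0F 2F p = ⊥-elim (no-1-cycle (subst (NextMod m (col 1F)) (nextMod-functional p (col-next 0F)) (col-next 1F)))
  col-step 1F 0F p = ⊥-elim (no-2-cycle p (col-next 0F))
  col-step 1F 1F p = ⊥-elim (no-1-cycle p)
  col-step 1F 2F p = 1F , refl , refl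
  col-step 2F 0F p = ⊥-elim (no-3-cycle p (col-next 0F) (col-next 1F))
  col-step 2F 1F p = ⊥-elim (no-2-cycle p (col-next 1F))
  col-step 2F 2F p = ⊥-elim (no-1-cycle p)

  col-injective : ∀ x y → col x ≡ col y → x ≡ y
  col-injective 0F 0F _ = refl
  col-injective 1F 1F _ = refl
  col-injective 2F 2F _ = refl
  col-injective 0F 1F e = ⊥-elim (no-1-cycle (subst (NextMod m _) (sym e) (col-next 0F)))
  col-injective 1F 0F e = ⊥-elim (no-1-cycle (subst (NextMod m _) e (col-next 0F)))
  col-injective 1F 2F e = ⊥-elim (no-1-cycle (subst (NextMod m _) (sym e) (col-next 1F)))
  col-injective 2F 1F e = ⊥-elim (no-1-cycle (subst (NextMod m _) e (col-next 1F)))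
  col-injective 0F 2F e = ⊥-elim (no-2-cycle (col-next 0F) (subst (NextMod m _) (sym e) (col-next 1F)))
  col-injective 2F 0F e = ⊥-elim (no-2-cycle (col-next 0F) (subst (NextMod m _) e (col-next 1F)))

  diagonals : Fin 2 → Fin 2 → Bool
  diagonals = square (d (cell 0F) (col 0F)) (d (cell 0F) (col 1F)) (d (cell 1F) (col 0F)) (d (cell 1F) (col 1F))

  diagonals-correct : ∀ a b → diagonals a b ≡ d (cell a) (col (inject₁ b))
  diagonals-correct 0F 0F = refl
  diagonals-correct 0F 1F = refl
  diagonals-correct 1F 0F = refl
  diagonals-correct 1F 1F = refl

  embed : Position → Vertex m (suc n)
  embed (x , y) = row x , col y

  embed-injective : ∀ p q → embed p ≡ embed q → p ≡ q
  embed-injective (x , y) (x′ , y′) e =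
    cong₂ _,_ (row-injective x x′ (cong proj₁ e)) (col-injective y y′ (cong proj₂ e))

  embed-edge : ∀ {p q} → PatchEdge diagonals p q → TEdge m (suc n) d (embed p) (embed q)
  embed-edge (horiz i b) = horiz (row i) _ _ (col-next b)
  embed-edge (vert a j) rewrite row-inject₁ a | row-suc a = vert (cell a) (col j)
  embed-edge (diag₁ a b t) rewrite row-inject₁ a | row-suc a =
    diag₁ (cell a) _ _ (col-next b) (trans (sym (diagonals-correct a b)) t)
  embed-edge (diag₂ a b f) rewrite row-inject₁ a | row-suc a =
    diag₂ (cell a) _ _ (col-next b) (trans (sym (diagonals-correct a b)) f)

  -- The endpoints enter through equations, because the indices of `TEdge` cannot be matched against
  -- the function `embed`.
  reflect-edge : ∀ {u v} → TEdge m (suc n) d u v → ∀ p q → u ≡ embed p → v ≡ embed q → PatchEdge diagonals p q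
  reflect-edge (horiz i j j′ s) (x , y) (x′ , y′) refl e
    with row-injective x x′ (cong proj₁ e) | col-step y y′ (subst (NextMod m _) (cong proj₂ e) s)
  ... | refl | b , refl , refl = horiz x b
  reflect-edge (vert k j) (x , y) (x′ , y′) e e′
    with row-step k x x′ (cong proj₁ e) (cong proj₁ e′)
       | col-injective y y′ (trans (sym (cong proj₂ e)) (cong proj₂ e′))
  ... | a , refl , refl , _ | refl = vert a y
  reflect-edge (diag₁ k j j′ s t) (x , y) (x′ , y′) e e′
    with row-step k x x′ (cong proj₁ e) (cong proj₁ e′)
       | col-step y y′ (subst₂ (NextMod m) (cong proj₂ e) (cong proj₂ e′) s)
  ... | a , refl , refl , refl | b , refl , refl =
    diag₁ a b (trans (diagonals-correct a b) (trans (cong (d (cell a)) (sym (cong proj₂ e))) t))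
  reflect-edge (diag₂ k j j′ s f) (x , y) (x′ , y′) e e′
    with row-step k x′ x (cong proj₁ e′) (cong proj₁ e)
       | col-step y y′ (subst₂ (NextMod m) (cong proj₂ e) (cong proj₂ e′) s)
  ... | a , refl , refl , refl | b , refl , refl =
    diag₂ a b (trans (diagonals-correct a b) (trans (cong (d (cell a)) (sym (cong proj₂ e))) f))

  embed-iff : ∀ p q → PatchAdj diagonals p q ⇔ TAdj m (suc n) d (embed p) (embed q)
  embed-iff p q = mk⇔ (Sum.map embed-edge embed-edge)
    (Sum.map (λ e → reflect-edge e p q refl refl) (λ e → reflect-edge e q p refl refl))

  -- The equation says that an even number of diagonals pass through the centre of the patch;
  -- otherwise `odd-patch` gives a wheel.
  even-degree : ¬ InducedSubgraph 6 (WheelAdj 5) (Vertex m (suc n)) (TAdj m (suc n) d) →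
    ¬ InducedSubgraph 8 (WheelAdj 7) (Vertex m (suc n)) (TAdj m (suc n) d) →
    d (inject₁ c) (col 0F) xor d (inject₁ c) (col 1F) ≡ d (fsuc c) (col 0F) xor d (fsuc c) (col 1F)
  even-degree no5 no7
    with (d (inject₁ c) (col 0F) xor d (inject₁ c) (col 1F)) Bool.≟ (d (fsuc c) (col 0F) xor d (fsuc c) (col 1F))
  ... | yes e = e
  ... | no ne = ⊥-elim ([ no5 ∘ extend , no7 ∘ extend ]′ (odd-patch _ _ _ _ ne))
    where
    extend : ∀ {h H} → InducedSubgraph h H Position (PatchAdj diagonals) →
             InducedSubgraph h H (Vertex m (suc n)) (TAdj m (suc n) d)
    extend = induced-trans {Adj = TAdj m (suc n) d} embed embed-injective embed-iff

-- The colouring of the cylinder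

nextMod-total : ∀ {m} (j : Fin m) → ∃ λ j′ → NextMod m j j′
nextMod-total {suc m} j with suc (toℕ j) ℕ.<? suc m
... | yes l = fromℕ< l , inj₁ (Fin.toℕ-fromℕ< l)
... | no ¬l = fzero , inj₂ (refl , ℕ.≤-antisym (Fin.toℕ<n j) (ℕ.≮⇒≥ ¬l))

xor-exchange : ∀ a b c d → a xor b ≡ c xor d → a xor c ≡ b xor d
xor-exchange true  true  true  true  _ = refl
xor-exchange true  true  false false _ = refl
xor-exchange true  false true  false _ = refl
xor-exchange true  false false true  _ = refl
xor-exchange false true  true  false _ = refl
xor-exchange false true  false true  _ = refl
xor-exchange false false true  true  _ = refl
xor-exchange false false false false _ = refl

tEdge? : ∀ {m n} (d : Triangulation m n) u v → Dec (TEdge m n d u v)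
tEdge? {m} {n} d (i , j) (i′ , j′) = map′
  [ (λ { (refl , s) → horiz i j j′ s })
  , (λ { (c , inj₁ (refl , refl , refl)) → vert c j
       ; (c , inj₂ (inj₁ (refl , refl , s , t))) → diag₁ c j j′ s t
       ; (c , inj₂ (inj₂ (refl , refl , s , f))) → diag₂ c j j′ s f }) ]′
  (λ { (horiz _ _ _ s) → inj₁ (refl , s)
     ; (vert c _) → inj₂ (c , inj₁ (refl , refl , refl))
     ; (diag₁ c _ _ s t) → inj₂ (c , inj₂ (inj₁ (refl , refl , s , t)))
     ; (diag₂ c _ _ s f) → inj₂ (c , inj₂ (inj₂ (refl , refl , s , f))) })
  (((i Fin.≟ i′) ×-dec nextMod? m j j′) ⊎-dec Fin.any? λ c →
    ((inject₁ c Fin.≟ i) ×-dec (fsuc c Fin.≟ i′) ×-dec (j Fin.≟ j′)) ⊎-dec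
    (((inject₁ c Fin.≟ i) ×-dec (fsuc c Fin.≟ i′) ×-dec nextMod? m j j′ ×-dec (d c j Bool.≟ true)) ⊎-dec
     ((fsuc c Fin.≟ i) ×-dec (inject₁ c Fin.≟ i′) ×-dec nextMod? m j j′ ×-dec (d c j Bool.≟ false))))

tAdj? : ∀ {m n} (d : Triangulation m n) u v → Dec (TAdj m n d u v)
tAdj? d u v = tEdge? d u v ⊎-dec tEdge? d v u

record Signs {m n : ℕ} (d : Triangulation m n) : Set where
  field
    g      : Fin n → Bool
    h      : Fin m → Bool
    agree  : ∀ {c j} → d c j ≡ true → g c ≡ h j
    differ : ∀ {c j} → d c j ≡ false → g c ≡ not (h j)

-- By even degrees, the diagonals change between neighbouring sectors in the same way in every
-- layer, so the first layer and the first sector determine all of them. `h` is the first layer, and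
-- `g c` tells whether layer `c` agrees with it.
signs : ∀ {m n} → 4 ≤ m → (d : Triangulation m (suc n)) →
  ¬ InducedSubgraph 6 (WheelAdj 5) (Vertex m (suc n)) (TAdj m (suc n) d) →
  ¬ InducedSubgraph 8 (WheelAdj 7) (Vertex m (suc n)) (TAdj m (suc n) d) → Signs d
signs {suc m} {n} 4≤m d no5 no7 = record
  { g = λ c → not (d fzero fzero xor d c fzero)
  ; h = d fzero
  ; agree = λ {c} {j} t → trans (cong not (trans (columns c j) (cong (d fzero j xor_) t))) (not-xor-true _)
  ; differ = λ {c} {j} f → cong not (trans (columns c j) (trans (cong (d fzero j xor_) f) (Bool.xor-identityʳ _)))
  }
  where
  not-xor-true : ∀ b → not (b xor true) ≡ b
  not-xor-true true  = refl
  not-xor-true false = refl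

  consecutive-rows : ∀ c {j j′} → NextMod (suc m) j j′ →
    d (inject₁ c) j xor d (inject₁ c) j′ ≡ d (fsuc c) j xor d (fsuc c) j′
  consecutive-rows c {j} {j′} s = Patch.even-degree 4≤m d c col col-next no5 no7
    where
    col : Fin 3 → Fin (suc m)
    col 0F = j
    col 1F = j′
    col 2F = proj₁ (nextMod-total j′)
    col-next : ∀ b → NextMod (suc m) (col (inject₁ b)) (col (fsuc b))
    col-next 0F = s
    col-next 1F = proj₂ (nextMod-total j′)

  rows : ∀ c {j j′} → NextMod (suc m) j j′ → d fzero j xor d fzero j′ ≡ d c j xor d c j′
  rows = <-weakInduction (λ c → ∀ {j j′} → NextMod (suc m) j j′ → d fzero j xor d fzero j′ ≡ d c j xor d c j′)
    (λ _ → refl) (λ c ih s → trans (ih s) (consecutive-rows c s))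

  columns : ∀ c j → d fzero fzero xor d c fzero ≡ d fzero j xor d c j
  columns c = <-weakInduction (λ j → d fzero fzero xor d c fzero ≡ d fzero j xor d c j) refl
    (λ j ih → trans ih (xor-exchange (d fzero (inject₁ j)) (d fzero (fsuc j)) (d c (inject₁ j)) (d c (fsuc j))
      (rows c (inj₁ (cong suc (sym (Fin.toℕ-inject₁ j)))))))

-- Arithmetic of colours modulo 4

data Shift : Set where
  plus twice minus : Shift

shift : Shift → Fin 4 → Fin 4
shift plus  x = next x
shift twice x = next (next x)
shift minus x = next (next (next x))

sign : Bool → Shift
sign true  = plus
sign false = minus

shift-comm : ∀ s t x → shift s (shift t x) ≡ shift t (shift s x)
shift-comm plus  plus  x = refl
shift-comm plus  twice x = refl
shift-comm plus  minus x = refl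
shift-comm twice plus  x = refl
shift-comm twice twice x = refl
shift-comm twice minus x = refl
shift-comm minus plus  x = refl
shift-comm minus twice x = refl
shift-comm minus minus x = refl

-- `Shift` lists the nonzero residues only.
shift-≢ : ∀ s x → x ≢ shift s x
shift-≢ plus  0F ()
shift-≢ plus  1F ()
shift-≢ plus  2F ()
shift-≢ plus  3F ()
shift-≢ twice 0F ()
shift-≢ twice 1F ()
shift-≢ twice 2F ()
shift-≢ twice 3F ()
shift-≢ minus 0F ()
shift-≢ minus 1F ()
shift-≢ minus 2F ()
shift-≢ minus 3F ()

next⁴ : ∀ x → next (next (next (next x))) ≡ x
next⁴ 0F = refl
next⁴ 1F = refl
next⁴ 2F = refl
next⁴ 3F = refl

next-injective : ∀ {x y} → next x ≡ next y → x ≡ y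
next-injective {x} {y} e = trans (sym (next⁴ x)) (trans (cong (next ∘ next ∘ next) e) (next⁴ y))

shift≡next : ∀ s {x} → shift s x ≡ next x → s ≡ plus
shift≡next plus  _ = refl
shift≡next twice e = ⊥-elim (shift-≢ plus _ (sym (next-injective e)))
shift≡next minus e = ⊥-elim (shift-≢ twice _ (sym (next-injective e)))

next-shift≡ : ∀ s {x} → x ≡ next (shift s x) → s ≡ minus
next-shift≡ plus  e = ⊥-elim (shift-≢ twice _ e)
next-shift≡ twice e = ⊥-elim (shift-≢ minus _ e)
next-shift≡ minus _ = refl

sign≡plus : ∀ {b} → sign b ≡ plus → b ≡ true
sign≡plus {true} _ = refl

sign≡minus : ∀ {b} → sign b ≡ minus → b ≡ false
sign≡minus {false} _ = refl

-- Half a turn reverses a sign: 2 + 1 = -1 and 2 - 1 = 1 modulo 4. This and the next three lemmas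
-- read the sign off an edge that raises the colour by one.
sign-twice≡next : ∀ b x → shift (sign b) (shift twice x) ≡ next x → b ≡ false
sign-twice≡next false x _ = refl
sign-twice≡next true  x e = ⊥-elim (shift-≢ twice (next x) (sym e))

≡next-sign-twice : ∀ b x → x ≡ next (shift (sign b) (shift twice x)) → b ≡ true
≡next-sign-twice true  x _ = refl
≡next-sign-twice false x e = ⊥-elim (shift-≢ twice x (trans e (next⁴ _)))

twice≡next-sign : ∀ b x → shift twice x ≡ next (shift (sign b) x) → b ≡ true
twice≡next-sign true  x _ = refl
twice≡next-sign false x e = ⊥-elim (shift-≢ twice _ e)

sign≡next-twice : ∀ b x → shift (sign b) x ≡ next (shift twice x) → b ≡ false
sign≡next-twice false x _ = refl
sign≡next-twice true  x e = ⊥-elim (shift-≢ twice _ e)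

sign-sign : ∀ b x → shift (sign b) (shift (sign b) x) ≡ shift twice x
sign-sign true  x = refl
sign-sign false x = cong (next ∘ next) (next⁴ x)

sign-not≢next-sign : ∀ b x → shift (sign (not b)) x ≢ next (shift (sign b) x)
sign-not≢next-sign true  x e = shift-≢ plus _ (sym e)
sign-not≢next-sign false x e = shift-≢ plus x (sym (trans e (next⁴ x)))

-- Partial compositions, used for the colours modulo 4 and for the integer heights alike.
walk : ∀ {X : Set} {n} → (Fin n → X → X) → X → Fin (suc n) → X
walk f x fzero              = x
walk {n = suc n} f x (fsuc i) = walk (f ∘ fsuc) (f fzero x) i

walk-suc : ∀ {X : Set} {n} (f : Fin n → X → X) x c → walk f x (fsuc c) ≡ f c (walk f x (inject₁ c))
walk-suc f x fzero    = refl
walk-suc f x (fsuc c) = walk-suc (f ∘ fsuc) (f fzero x) c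

-- Shifts commute, so a horizontal step acts in the same way on every layer.
walk-shift : ∀ {n} (t : Fin n → Shift) s x i → walk (shift ∘ t) (shift s x) i ≡ shift s (walk (shift ∘ t) x i)
walk-shift t s x fzero = refl
walk-shift {suc n} t s x (fsuc i) =
  trans (cong (λ y → walk (shift ∘ t ∘ fsuc) y i) (shift-comm (t fzero) s x)) (walk-shift (t ∘ fsuc) s _ i)

unit : Bool → ℤ
unit true  = 1ℤ
unit false = -1ℤ

-- Indexed by ℕ, so that `total k m` is the change of colour once around the cylinder.
total : (ℕ → Shift) → ℕ → Fin 4
total k zero    = 0F
total k (suc j) = shift (k j) (total k j)

-- The horizontal steps of the colouring: half a turn, or the sign of the column, closing up
-- to a whole number of turns around the cylinder.
record HorizontalSteps {m : ℕ} (h : Fin m → Bool) : Set where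
  field
    step   : ℕ → Shift
    closed : total step m ≡ 0F
    step-cases : ∀ j → step (toℕ j) ≡ twice ⊎ (step (toℕ j) ≡ sign (h j) × m ≢ 4)

-- With half turns only, the total is a whole number of turns iff m is even. Otherwise two of
-- the first three columns have equal signs, and replacing their half turns by their signs
-- changes the total by half a turn.
horizontalSteps : ∀ {m} → 4 ≤ m → (h : Fin m → Bool) → HorizontalSteps h
horizontalSteps {suc (suc (suc (suc m)))} (s≤s (s≤s (s≤s (s≤s z≤n)))) h with halves (4 + m)
  where
  halves : ∀ j → total (λ _ → twice) j ≡ 0F ⊎ total (λ _ → twice) j ≡ 2F
  halves zero = inj₁ refl
  halves (suc j) with halves j
  ... | inj₁ e = inj₂ (cong (shift twice) e)
  ... | inj₂ e = inj₁ (cong (shift twice) e)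
... | inj₁ e = record { step = λ _ → twice ; closed = e ; step-cases = λ _ → inj₁ refl }
... | inj₂ e = choose (h 0F) (h 1F) (h 2F) refl refl refl
  where
  first : Shift → Shift → Shift → ℕ → Shift
  first a b c 0 = a
  first a b c 1 = b
  first a b c 2 = c
  first a b c (suc (suc (suc _))) = twice

  closes : ∀ {a b c} → total (first a b c) 3 ≡ 0F → total (first a b c) (4 + m) ≡ 0F
  -- Three half turns make 2, so after three columns the two totals differ by half a turn, and this
  -- difference persists.
  closes {a} {b} {c} z = trans (tail (1 + m)) (cong (shift twice) e)
    where
    tail : ∀ k → total (first a b c) (3 + k) ≡ shift twice (total (λ _ → twice) (3 + k))
    tail zero    = z
    tail (suc k) = cong (shift twice) (tail k)

  -- Four half turns already close up.
  m≢4 : 4 + m ≢ 4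
  m≢4 q with () ← trans (sym (cong (total (λ _ → twice)) q)) e

  make : ∀ a b c → total (first a b c) 3 ≡ 0F → (a ≡ twice ⊎ a ≡ sign (h 0F)) →
         (b ≡ twice ⊎ b ≡ sign (h 1F)) → (c ≡ twice ⊎ c ≡ sign (h 2F)) → HorizontalSteps h
  make a b c z p q r = record { step = first a b c ; closed = closes {a} {b} {c} z ; step-cases = λ where
    0F                     → Sum.map₂ (_, m≢4) p
    1F                     → Sum.map₂ (_, m≢4) q
    2F                     → Sum.map₂ (_, m≢4) r
    (fsuc (fsuc (fsuc _))) → inj₁ refl }

  choose : ∀ x y z → h 0F ≡ x → h 1F ≡ y → h 2F ≡ z → HorizontalSteps h
  choose true  true  _     p q r = make plus  plus  twice refl (inj₂ (cong sign (sym p))) (inj₂ (cong sign (sym q))) (inj₁ refl)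
  choose false false _     p q r = make minus minus twice refl (inj₂ (cong sign (sym p))) (inj₂ (cong sign (sym q))) (inj₁ refl)
  choose true  false true  p q r = make plus  twice plus  refl (inj₂ (cong sign (sym p))) (inj₁ refl) (inj₂ (cong sign (sym r)))
  choose false true  false p q r = make minus twice minus refl (inj₂ (cong sign (sym p))) (inj₁ refl) (inj₂ (cong sign (sym r)))
  choose true  false false p q r = make twice minus minus refl (inj₁ refl) (inj₂ (cong sign (sym q))) (inj₂ (cong sign (sym r)))
  choose false true  true  p q r = make twice plus  plus  refl (inj₁ refl) (inj₂ (cong sign (sym q))) (inj₂ (cong sign (sym r)))

module Colouring {m n : ℕ} (4≤m : 4 ≤ m) (d : Triangulation m n) (σ : Signs d) where

  open Cycle 4≤m
  open Signs σ
  open HorizontalSteps (horizontalSteps 4≤m h)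

  colour : Vertex m n → Fin 4
  colour (i , j) = walk (shift ∘ sign ∘ g) (total step (toℕ j)) i

  colour-vert : ∀ c j → colour (fsuc c , j) ≡ shift (sign (g c)) (colour (inject₁ c , j))
  colour-vert c j = walk-suc (shift ∘ sign ∘ g) (total step (toℕ j)) c

  colour-horiz : ∀ i {j j′} → NextMod m j j′ → colour (i , j′) ≡ shift (step (toℕ j)) (colour (i , j))
  colour-horiz i {j} {j′} s =
    trans (cong (λ x → walk (shift ∘ sign ∘ g) x i) (total-next s)) (walk-shift (sign ∘ g) (step (toℕ j)) _ i)
    where
    total-next : NextMod m j j′ → total step (toℕ j′) ≡ shift (step (toℕ j)) (total step (toℕ j))
    total-next (inj₁ e)       = cong (total step) e
    total-next (inj₂ (e , f)) = trans (cong (total step) e) (trans (sym closed) (cong (total step) (sym f)))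

  -- Moving from column j to column j′ increases the sum of the signs of the columns by one.
  data Up : Fin m → Fin m → Set where
    fwd : ∀ {j j′} → NextMod m j j′ → h j ≡ true → Up j j′
    bwd : ∀ {j j′} → NextMod m j′ j → h j′ ≡ false → Up j j′

  -- The integer lift of the layer part of the colour: closed walks must balance exactly, not only
  -- modulo 4.
  height : Fin (suc n) → ℤ
  height = walk (λ c → unit (g c) +ℤ_) 0ℤ

  height-suc : ∀ c {b} → g c ≡ b → height (fsuc c) ≡ unit b +ℤ height (inject₁ c)
  height-suc c refl = walk-suc (λ c → unit (g c) +ℤ_) 0ℤ c

  height-inject₁ : ∀ c {b} → g c ≡ b → height (inject₁ c) ≡ unit (not b) +ℤ height (fsuc c)
  height-inject₁ c {b} e = begin
    height (inject₁ c)                            ≡⟨ ℤ.+-identityˡ _ ⟨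
    0ℤ +ℤ height (inject₁ c)                      ≡⟨ cong (_+ℤ height (inject₁ c)) (cancel b) ⟨
    (unit (not b) +ℤ unit b) +ℤ height (inject₁ c) ≡⟨ ℤ.+-assoc (unit (not b)) (unit b) _ ⟩
    unit (not b) +ℤ (unit b +ℤ height (inject₁ c)) ≡⟨ cong (unit (not b) +ℤ_) (height-suc c e) ⟨
    unit (not b) +ℤ height (fsuc c)               ∎
    where
    open ≡-Reasoning
    cancel : ∀ b → unit (not b) +ℤ unit b ≡ 0ℤ
    cancel true  = refl
    cancel false = refl

  data Kind : Set where
    V H X : Kind

  weight : Kind → ℤ
  weight V = 1ℤ
  weight H = 0ℤ
  weight X = -1ℤ

  -- `V`, `H`, `X` are the changes (1 , 0), (0 , 1), (-1 , -1) of (A , B). A move `H` crosses an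
  -- exceptional sector, whence `m ≢ 4`.
  ColumnMove : Kind → Fin m → Fin m → Set
  ColumnMove V j j′ = j ≡ j′
  ColumnMove H j j′ = Up j j′ × m ≢ 4
  ColumnMove X j j′ = Up j′ j

  Move : Vertex m n → Vertex m n → Set
  Move (i , j) (i′ , j′) = ∃ λ k → height i′ ≡ weight k +ℤ height i × ColumnMove k j j′

  colour-horiz-by : ∀ i {j j′ t} → NextMod m j j′ → step (toℕ j) ≡ t → colour (i , j′) ≡ shift t (colour (i , j))
  colour-horiz-by i s refl = colour-horiz i s

  colour-diag : ∀ c {j j′ t} → NextMod m j j′ → step (toℕ j) ≡ t →
                colour (fsuc c , j′) ≡ shift (sign (g c)) (shift t (colour (inject₁ c , j)))
  colour-diag c {j′ = j′} s e = trans (colour-vert c j′) (cong (shift (sign (g c))) (colour-horiz-by (inject₁ c) s e))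

  -- A diagonal changes the colour by the sum or difference of a sign and the step of its sector.
  -- This is odd if the step is half a turn. If the step is a sign, it is 2, as the signs agree on
  -- `diag₁` and differ on `diag₂`.
  proper-edge : ∀ {u v} → TEdge m n d u v → colour u ≢ colour v
  proper-edge (horiz i j j′ s) e = shift-≢ (step (toℕ j)) _ (trans e (colour-horiz i s))
  proper-edge (vert c j) e = shift-≢ (sign (g c)) _ (trans e (colour-vert c j))
  proper-edge (diag₁ c j j′ s t) e with step-cases j
  ... | inj₁ st = sign-twice≢ (g c) _ (trans e (colour-diag c s st))
    where
    sign-twice≢ : ∀ b x → x ≢ shift (sign b) (shift twice x)
    sign-twice≢ true  x e = shift-≢ minus x e
    sign-twice≢ false x e = shift-≢ plus x (trans e (next⁴ (next x)))
  ... | inj₂ (st , _) = shift-≢ twice _ (trans e (trans (colour-diag c s (trans st (cong sign (sym (agree t)))))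
                          (sign-sign (g c) _)))
  proper-edge (diag₂ c j j′ s f) e with step-cases j
  ... | inj₁ st = sign≢twice (g c) _ (trans (sym (colour-vert c j)) (trans e (colour-horiz-by (inject₁ c) s st)))
    where
    sign≢twice : ∀ b x → shift (sign b) x ≢ shift twice x
    sign≢twice true  x e = shift-≢ plus _ e
    sign≢twice false x e = shift-≢ plus _ (sym e)
  ... | inj₂ (st , _) = sign-not≢sign (h j) _ (trans (cong (λ b → shift (sign b) (colour (inject₁ c , j))) (sym (differ f)))
                          (trans (sym (colour-vert c j)) (trans e (colour-horiz-by (inject₁ c) s st))))
    where
    sign-not≢sign : ∀ b x → shift (sign (not b)) x ≢ shift (sign b) x
    sign-not≢sign true  x e = shift-≢ twice _ (sym e)
    sign-not≢sign false x e = shift-≢ twice _ e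

  proper : ∀ {u v} → TAdj m n d u v → colour u ≢ colour v
  proper (inj₁ e) = proper-edge e
  proper (inj₂ e) = ≢-sym (proper-edge e)

  sign-of-step : ∀ j {t} → t ≢ twice → step (toℕ j) ≡ t → sign (h j) ≡ t × m ≢ 4
  sign-of-step j t≢ st with step-cases j
  ... | inj₁ st′         = ⊥-elim (t≢ (trans (sym st) st′))
  ... | inj₂ (st′ , m≢4) = trans (sym st′) st , m≢4

  -- Horizontal edges raise the colour by one only in exceptional sectors. Diagonals do so only in
  -- the others, where half a turn reverses the sign and both coordinates drop.
  move : ∀ {u v} → TAdj m n d u v → colour v ≡ next (colour u) → Move u v
  move (inj₁ (horiz i j j′ s)) e
    with sign-of-step j (λ ()) (shift≡next _ (trans (sym (colour-horiz i s)) e))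
  ... | p , m≢4 = H , sym (ℤ.+-identityˡ _) , fwd s (sign≡plus p) , m≢4
  move (inj₂ (horiz i j j′ s)) e
    with sign-of-step j (λ ()) (next-shift≡ _ (trans e (cong next (colour-horiz i s))))
  ... | p , m≢4 = H , sym (ℤ.+-identityˡ _) , bwd s (sign≡minus p) , m≢4
  move (inj₁ (vert c j)) e =
    V , height-suc c (sign≡plus (shift≡next _ (trans (sym (colour-vert c j)) e))) , refl
  move (inj₂ (vert c j)) e =
    V , height-inject₁ c (sign≡minus (next-shift≡ _ (trans e (cong next (colour-vert c j))))) , refl
  move (inj₁ (diag₁ c j j′ s t)) e with step-cases j
  ... | inj₁ st = X , height-suc c g≡ , bwd s (trans (sym (agree t)) g≡)
    where g≡ = sign-twice≡next (g c) _ (trans (sym (colour-diag c s st)) e)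
  ... | inj₂ (st , _) = ⊥-elim (shift-≢ plus _ (sym (trans (sym (trans (colour-diag c s (trans st (cong sign (sym (agree t)))))
                          (sign-sign (g c) _))) e)))
  move (inj₂ (diag₁ c j j′ s t)) e with step-cases j
  ... | inj₁ st = X , height-inject₁ c g≡ , fwd s (trans (sym (agree t)) g≡)
    where g≡ = ≡next-sign-twice (g c) _ (trans e (cong next (colour-diag c s st)))
  ... | inj₂ (st , _) = ⊥-elim (shift-≢ minus _ (trans e (cong next
                          (trans (colour-diag c s (trans st (cong sign (sym (agree t))))) (sign-sign (g c) _)))))
  move (inj₁ (diag₂ c j j′ s f)) e with step-cases j
  ... | inj₁ st = X , height-inject₁ c g≡ , bwd s (Bool.not-injective (trans (sym (differ f)) g≡))
    where g≡ = twice≡next-sign (g c) _ (trans (sym (colour-horiz-by (inject₁ c) s st)) (trans e (cong next (colour-vert c j))))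
  ... | inj₂ (st , _) = ⊥-elim (sign-not≢next-sign (g c) _
                          (trans (sym (colour-horiz-by (inject₁ c) s (trans st (cong sign (sym (trans (cong not (differ f)) (Bool.not-involutive _)))))))
                            (trans e (cong next (colour-vert c j)))))
  move (inj₂ (diag₂ c j j′ s f)) e with step-cases j
  ... | inj₁ st = X , height-suc c g≡ , fwd s (Bool.not-injective (trans (sym (differ f)) g≡))
    where g≡ = sign≡next-twice (g c) _ (trans (sym (colour-vert c j)) (trans e (cong next (colour-horiz-by (inject₁ c) s st))))
  ... | inj₂ (st , _) = ⊥-elim (sign-not≢next-sign (h j) _
                          (trans (cong (λ b → shift (sign b) (colour (inject₁ c , j))) (sym (differ f)))
                            (trans (sym (colour-vert c j)) (trans e (cong next (colour-horiz-by (inject₁ c) s st))))))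

  -- Closed walks of rising edges

  up-asym : ∀ {j k} → Up j k → ¬ Up k j
  up-asym (fwd p _) (fwd q _) = no-2-cycle p q
  up-asym (bwd p _) (bwd q _) = no-2-cycle p q
  up-asym (fwd _ a) (bwd _ b) with () ← trans (sym a) b
  up-asym (bwd _ a) (fwd _ b) with () ← trans (sym a) b

  fwd-bwd : ∀ {j k l} → NextMod m j k → h j ≡ true → NextMod m l k → h l ≢ false
  fwd-bwd p a q b with refl ← nextMod-injective p q with () ← trans (sym a) b

  bwd-fwd : ∀ {k} → h k ≡ false → h k ≢ true
  bwd-fwd a b with () ← trans (sym a) b

  -- An `Up` move cannot turn back, as the sector just crossed has the wrong sign for it. So all
  -- four moves go the same way round.
  up-4-cycle : ∀ {j k l o} → Up j k → Up k l → Up l o → Up o j → m ≡ 4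
  up-4-cycle (fwd p _) (fwd q _) (fwd r _) (fwd s _) = 4-cycle p q r s
  up-4-cycle (bwd p _) (bwd q _) (bwd r _) (bwd s _) = 4-cycle s r q p
  up-4-cycle (fwd p a) (bwd q b) _         _         = ⊥-elim (fwd-bwd p a q b)
  up-4-cycle _         (fwd p a) (bwd q b) _         = ⊥-elim (fwd-bwd p a q b)
  up-4-cycle _         _         (fwd p a) (bwd q b) = ⊥-elim (fwd-bwd p a q b)
  up-4-cycle (bwd _ a) (fwd _ b) _         _         = ⊥-elim (bwd-fwd a b)
  up-4-cycle _         (bwd _ a) (fwd _ b) _         = ⊥-elim (bwd-fwd a b)
  up-4-cycle _         _         (bwd _ a) (fwd _ b) = ⊥-elim (bwd-fwd a b)

  Near : Fin m → Fin m → Set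
  Near j k = NextMod m j k ⊎ NextMod m k j

  up-near : ∀ {j k} → Up j k → Near j k
  up-near (fwd p _) = inj₁ p
  up-near (bwd p _) = inj₂ p

  -- Three steps in one direction would wind around with `m` at most 3; otherwise two steps cancel
  -- and the third is a loop.
  no-triangle : ∀ {j k l} → Near j k → Near k l → ¬ Near l j
  no-triangle (inj₁ p) (inj₁ q) (inj₁ r) = no-3-cycle p q r
  no-triangle (inj₂ p) (inj₂ q) (inj₂ r) = no-3-cycle r q p
  no-triangle (inj₁ p) (inj₁ q) (inj₂ r) with refl ← nextMod-functional p r = no-1-cycle q
  no-triangle (inj₁ p) (inj₂ q) (inj₁ r) with refl ← nextMod-functional q r = no-1-cycle p
  no-triangle (inj₂ p) (inj₁ q) (inj₁ r) with refl ← nextMod-functional p q = no-1-cycle r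
  no-triangle (inj₁ p) (inj₂ q) (inj₂ r) with refl ← nextMod-injective p q = no-1-cycle r
  no-triangle (inj₂ p) (inj₁ q) (inj₂ r) with refl ← nextMod-injective q r = no-1-cycle p
  no-triangle (inj₂ p) (inj₂ q) (inj₁ r) with refl ← nextMod-injective p r = no-1-cycle q

  -- Balanced heights mean equally many `V` and `X`. Four `H` wind around, so `m` would be 4; two
  -- `X` would cross between two columns in both directions; one `X` and two `H` would form a
  -- triangle of columns.
  closed-walk : ∀ k₁ k₂ k₃ k₄ → weight k₄ +ℤ (weight k₃ +ℤ (weight k₂ +ℤ weight k₁)) ≡ 0ℤ →
    ∀ {a b c e} → ColumnMove k₁ a b → ColumnMove k₂ b c → ColumnMove k₃ c e → ColumnMove k₄ e a → ⊥
  closed-walk H H H H _ (p , m≢4) (q , _) (r , _) (s , _) = m≢4 (up-4-cycle p q r s)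
  closed-walk V V X X _ refl refl p q = up-asym p q
  closed-walk V X V X _ refl p refl q = up-asym p q
  closed-walk V X X V _ refl p q refl = up-asym p q
  closed-walk X V V X _ p refl refl q = up-asym p q
  closed-walk X V X V _ p refl q refl = up-asym p q
  closed-walk X X V V _ p q refl refl = up-asym p q
  closed-walk V X H H _ refl p (q , _) (r , _) = no-triangle (swap (up-near p)) (up-near q) (up-near r)
  closed-walk V H X H _ refl (p , _) q (r , _) = no-triangle (up-near p) (swap (up-near q)) (up-near r)
  closed-walk V H H X _ refl (p , _) (q , _) r = no-triangle (up-near p) (up-near q) (swap (up-near r))
  closed-walk X V H H _ p refl (q , _) (r , _) = no-triangle (swap (up-near p)) (up-near q) (up-near r)
  closed-walk H V X H _ (p , _) refl q (r , _) = no-triangle (up-near p) (swap (up-near q)) (up-near r)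
  closed-walk H V H X _ (p , _) refl (q , _) r = no-triangle (up-near p) (up-near q) (swap (up-near r))
  closed-walk X H V H _ p (q , _) refl (r , _) = no-triangle (swap (up-near p)) (up-near q) (up-near r)
  closed-walk H X V H _ (p , _) q refl (r , _) = no-triangle (up-near p) (swap (up-near q)) (up-near r)
  closed-walk H H V X _ (p , _) (q , _) refl r = no-triangle (up-near p) (up-near q) (swap (up-near r))
  closed-walk X H H V _ p (q , _) (r , _) refl = no-triangle (swap (up-near p)) (up-near q) (up-near r)
  closed-walk H X H V _ (p , _) q (r , _) refl = no-triangle (up-near p) (swap (up-near q)) (up-near r)
  closed-walk H H X V _ (p , _) (q , _) r refl = no-triangle (up-near p) (up-near q) (swap (up-near r))
  closed-walk V V V V ()
  closed-walk V V V H ()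
  closed-walk V V H V ()
  closed-walk V V H H ()
  closed-walk V V X V ()
  closed-walk V V X H ()
  closed-walk V H V V ()
  closed-walk V H V H ()
  closed-walk V H V X ()
  closed-walk H V V V ()
  closed-walk H V V H ()
  closed-walk H V V X ()
  closed-walk H X X V ()
  closed-walk H X X H ()
  closed-walk H X X X ()
  closed-walk X H X V ()
  closed-walk X H X H ()
  closed-walk X H X X ()
  closed-walk X X H V ()
  closed-walk X X H H ()
  closed-walk X X H X ()
  closed-walk X X X V ()
  closed-walk X X X H ()
  closed-walk X X X X ()

  no-rainbow : ∀ {a b c e} → TAdj m n d a b → TAdj m n d b c → TAdj m n d c e → TAdj m n d e a →
    colour b ≡ next (colour a) → colour c ≡ next (colour b) →
    colour e ≡ next (colour c) → colour a ≡ next (colour e) → ⊥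
  no-rainbow {a} {b} {c} {e} ab bc ce ea p q r s with move ab p | move bc q | move ce r | move ea s
  ... | k₁ , w₁ , m₁ | k₂ , w₂ , m₂ | k₃ , w₃ , m₃ | k₄ , w₄ , m₄ = closed-walk k₁ k₂ k₃ k₄ balanced m₁ m₂ m₃ m₄
    where
    open ≡-Reasoning
    x = height (proj₁ a)
    balanced : weight k₄ +ℤ (weight k₃ +ℤ (weight k₂ +ℤ weight k₁)) ≡ 0ℤ
    -- The four changes of height lead from `x` back to `x`, so their sum vanishes.
    balanced = identityˡ-unique ℤ.+-0-abelianGroup _ x (begin
      (weight k₄ +ℤ (weight k₃ +ℤ (weight k₂ +ℤ weight k₁))) +ℤ x ≡⟨ ℤ.+-assoc (weight k₄) _ x ⟩
      weight k₄ +ℤ ((weight k₃ +ℤ (weight k₂ +ℤ weight k₁)) +ℤ x) ≡⟨ cong (weight k₄ +ℤ_) (ℤ.+-assoc (weight k₃) _ x) ⟩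
      weight k₄ +ℤ (weight k₃ +ℤ ((weight k₂ +ℤ weight k₁) +ℤ x)) ≡⟨ cong (λ y → weight k₄ +ℤ (weight k₃ +ℤ y)) (ℤ.+-assoc (weight k₂) _ x) ⟩
      weight k₄ +ℤ (weight k₃ +ℤ (weight k₂ +ℤ (weight k₁ +ℤ x))) ≡⟨ cong (λ y → weight k₄ +ℤ (weight k₃ +ℤ (weight k₂ +ℤ y))) w₁ ⟨
      weight k₄ +ℤ (weight k₃ +ℤ (weight k₂ +ℤ height (proj₁ b)))≡⟨ cong (λ y → weight k₄ +ℤ (weight k₃ +ℤ y)) w₂ ⟨
      weight k₄ +ℤ (weight k₃ +ℤ height (proj₁ c))               ≡⟨ cong (weight k₄ +ℤ_) w₃ ⟨
      weight k₄ +ℤ height (proj₁ e)                              ≡⟨ w₄ ⟨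
      x                                                           ∎)

  representable : WordRepresentable (Vertex m n) _≟V_ (TAdj m n d)
  representable = FourColouring.wordRepresentable _≟V_ (TAdj m n d) (tAdj? d) swap
    (cartesianProduct (allFin (suc n)) (allFin m)) (Unique.cartesianProduct⁺ (Unique.allFin⁺ (suc n)) (Unique.allFin⁺ m))
    (λ (i , j) → ∈-cartesianProduct⁺ (∈-allFin i) (∈-allFin j))
    colour proper no-rainbow

theorem3 : (m n : ℕ) → 4 ≤ m → 1 ≤ n → (T : Triangulation m n) →
    WordRepresentable (Vertex m n) _≟V_ (TAdj m n T) ⇔
    ((¬ InducedSubgraph 6 (WheelAdj 5) (Vertex m n) (TAdj m n T)) ×
    (¬ InducedSubgraph 8 (WheelAdj 7) (Vertex m n) (TAdj m n T)))
theorem3 m (suc n) 4≤m _ T = mk⇔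
  (λ R → no-W₅ _≟V_ R , no-W₇ _≟V_ R)
  (λ (no5 , no7) → Colouring.representable 4≤m T (signs 4≤m T no5 no7))
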